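{- If a tree $G$ is great-circle thrackleable, then $G$ is an augmented caterpillar.
   Context: Graphs are finite, simple and undirected. A thrackle is a drawing of a graph in which no curve (edge) crosses itself and every pair of curves (edges) intersects at exactly one point (so two edges with a common endpoint meet only at that endpoint, and two edges with no common endpoint meet at exactly one point). A great-circle thrackle is a thrackle drawn on the unit sphere $S^2$ whose vertices are represented as (distinct) points of the sphere and whose edges are represented by arcs of great circles joining their endpoints (an arc may be shorter or longer than $\pi$). It is in general position if no three vertices lie on the same great circle and no two vertices are antipodal. A graph is great-circle thrackleable if it can be drawn as a great-circle thrackle in general position. An augmented caterpillar is a tree consisting of a spine, which is a longest path of the tree, and legs, which are paths that are edge-disjoint from the spine but which terminate at internal vertices of the spine, such that every vertex of the tree is at distance at most two from an internal vertex of the spine. (Trees with at most two vertices, whose spine has no internal vertex, are counted as augmented caterpillars by convention.) -}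

module Defs where

open import Algebra.Bundles using (CommutativeRing)
import Algebra.Properties.Monoid.Mult as Mult
import Algebra.Properties.Monoid.Sum as Sum
open import Data.Bool.Base using (Bool; T)
open import Data.Fin.Base as Fin using (Fin)
open import Data.List.Base using (List; []; _∷_)
open import Data.List.Membership.Propositional using (_∈_)
open import Data.List.Relation.Unary.Unique.Propositional using (Unique)
open import Data.Nat.Base as ℕ using (ℕ; suc; NonZero)
open import Data.Product using (Σ; Σ-syntax; ∃; ∃-syntax; ∃!; _×_; _,_; proj₁; proj₂)
open import Data.Sum.Base using (_⊎_)
open import Data.Vec.Functional using (Vector; zipWith)
open import Level using (Level; _⊔_) renaming (suc to lsuc)
open import Relation.Binary.Construct.Closure.ReflexiveTransitive using (Star; ε; _◅_)
open import Relation.Binary.Core using (Rel)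
open import Relation.Binary.Definitions using (Cotransitive; Irreflexive; Symmetric)
open import Relation.Binary.PropositionalEquality.Core using (_≡_; _≢_)
open import Relation.Binary.Structures using (IsStrictPartialOrder)
open import Relation.Nullary.Negation.Core using (¬_)

------------------------------------------------------------------------
-- The real numbers

-- The library has no real numbers, so ℝ is given axiomatically, as an
-- Archimedean, Cauchy-complete ordered field; this determines it up to
-- isomorphism. The axioms are the constructive ones (cotransitivity of <
-- instead of trichotomy); under excluded middle they are equivalent to
-- the usual axioms for ℝ.

record RealNumbers (c ℓ : Level) : Set (lsuc (c ⊔ ℓ)) where
  infix 4 _<_ _≤_
  field
    commutativeRing : CommutativeRing c ℓ

  open CommutativeRing commutativeRing public
  open Mult +-monoid public using () renaming (_×_ to _·_)

  field
    _<_                    : Rel Carrier ℓ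
    <-isStrictPartialOrder : IsStrictPartialOrder _≈_ _<_
    <-cotrans              : Cotransitive _<_
    <-connex               : ∀ {x y} → ¬ (x < y) → ¬ (y < x) → x ≈ y
    0<1                    : 0# < 1#
    +-monoˡ-<              : ∀ {x y} z → x < y → x + z < y + z
    *-pos                  : ∀ {x y} → 0# < x → 0# < y → 0# < x * y
    inverse                : ∀ {x} → 0# < x → ∃[ y ] x * y ≈ 1#
    archimedean            : ∀ x → ∃[ n ] x < n · 1#

  _≤_ : Rel Carrier ℓ
  x ≤ y = ¬ (y < x)

  -- As m and k range over all pairs of indices, bounding a m - a k also
  -- bounds its absolute value.
  IsCauchy : (ℕ → Carrier) → Set (c ⊔ ℓ)
  IsCauchy a = ∀ e → 0# < e →
    ∃[ N ] (∀ m k → N ℕ.≤ m → N ℕ.≤ k → a m - a k < e)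

  ConvergesTo : (ℕ → Carrier) → Carrier → Set (c ⊔ ℓ)
  ConvergesTo a l = ∀ e → 0# < e →
    ∃[ N ] (∀ m → N ℕ.≤ m → (a m - l < e) × (l - a m < e))

  field
    complete : ∀ a → IsCauchy a → ∃[ l ] ConvergesTo a l

------------------------------------------------------------------------
-- Finite simple undirected graphs

record Graph : Set where
  infix 4 _~_
  field
    order : ℕ
    adj   : Fin order → Fin order → Bool

  Vertex : Set
  Vertex = Fin order

  _~_ : Vertex → Vertex → Set
  u ~ v = T (adj u v)

  field
    ~-sym    : Symmetric _~_
    ~-irrefl : Irreflexive _≡_ _~_

  -- Each unordered edge occurs once, with its endpoints in increasing order.
  Edge : Set
  Edge = Σ[ (u , v) ∈ Vertex × Vertex ] (u Fin.< v × u ~ v)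

  endpoints : Edge → Vertex × Vertex
  endpoints = proj₁

  src tgt : Edge → Vertex
  src e = proj₁ (endpoints e)
  tgt e = proj₂ (endpoints e)

  Walk : Vertex → Vertex → Set
  Walk = Star _~_

  length : ∀ {u v} → Walk u v → ℕ
  length ε       = 0
  length (_ ◅ w) = suc (length w)

  vertices : ∀ {u v} → Walk u v → List Vertex
  vertices {u} ε       = u ∷ []
  vertices {u} (_ ◅ w) = u ∷ vertices w

  steps : ∀ {u v} → Walk u v → List (Vertex × Vertex)
  steps ε                         = []
  steps (_◅_ {i = u} {j = v} _ w) = (u , v) ∷ steps w

  Traverses : ∀ {u v} → Walk u v → Vertex → Vertex → Set
  Traverses w x y = (x , y) ∈ steps w ⊎ (y , x) ∈ steps w

  EdgeDisjoint : ∀ {u v u′ v′} → Walk u v → Walk u′ v′ → Set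
  EdgeDisjoint w w′ = ∀ x y → Traverses w x y → ¬ Traverses w′ x y

  IsPath : ∀ {u v} → Walk u v → Set
  IsPath w = Unique (vertices w)

  IsLongestPath : ∀ {u v} → Walk u v → Set
  IsLongestPath p = IsPath p ×
    (∀ {u v} (q : Walk u v) → IsPath q → length q ℕ.≤ length p)

  Internal : ∀ {u v} → Walk u v → Vertex → Set
  Internal {u} {v} p x = x ∈ vertices p × x ≢ u × x ≢ v

  DistanceAtMost : ℕ → Vertex → Vertex → Set
  DistanceAtMost k u v = Σ[ w ∈ Walk u v ] length w ℕ.≤ k

  Connected : Set
  Connected = ∀ u v → Walk u v

  -- A cycle is a path with at least two edges whose ends are adjacent.
  Acyclic : Set
  Acyclic = ∀ {u v} (p : Walk u v) → IsPath p → 2 ℕ.≤ length p → ¬ (v ~ u)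

  record IsTree : Set where
    field
      nonEmpty  : NonZero order
      connected : Connected
      acyclic   : Acyclic

  record Leg {u v} (spine : Walk u v) : Set where
    field
      {start end}  : Vertex
      path         : Walk start end
      isPath       : IsPath path
      edgeDisjoint : EdgeDisjoint path spine
      end-internal : Internal spine end

  record HasSpineAndLegs : Set where
    field
      {left right} : Vertex
      spine        : Walk left right
      longest      : IsLongestPath spine
      spine∪legs   : ∀ x y → x ~ y →
                     Traverses spine x y ⊎
                     (Σ[ l ∈ Leg spine ] Traverses (Leg.path l) x y)
      near-spine   : ∀ x → ∃[ y ] (Internal spine y × DistanceAtMost 2 x y)

  IsAugmentedCaterpillar : Set
  IsAugmentedCaterpillar = IsTree × (order ℕ.≤ 2 ⊎ HasSpineAndLegs)

------------------------------------------------------------------------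
-- Great-circle drawings on the unit sphere

module Sphere {c ℓ} (R : RealNumbers c ℓ) where
  open RealNumbers R
  open Sum +-monoid using (sum)

  ℝ³ : Set c
  ℝ³ = Vector Carrier 3

  infix 7 _∙_
  _∙_ : ℝ³ → ℝ³ → Carrier
  x ∙ y = sum (zipWith _*_ x y)

  NonZeroVector : ℝ³ → Set ℓ
  NonZeroVector x = ¬ (∀ i → x i ≈ 0#)

  S² : Set (c ⊔ ℓ)
  S² = Σ[ x ∈ ℝ³ ] x ∙ x ≈ 1#

  coords : S² → ℝ³
  coords = proj₁

  infix 4 _≈ₛ_
  _≈ₛ_ : S² → S² → Set ℓ
  x ≈ₛ y = ∀ i → coords x i ≈ coords y i

  Antipodal : S² → S² → Set ℓ
  Antipodal x y = ∀ i → coords x i ≈ - coords y i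

  -- A great circle is the intersection of the sphere with a plane through
  -- the origin, given by a normal vector of that plane.
  record GreatCircle : Set (c ⊔ ℓ) where
    field
      normal  : ℝ³
      nonzero : NonZeroVector normal

  infix 4 _on_
  _on_ : S² → GreatCircle → Set ℓ
  x on C = coords x ∙ GreatCircle.normal C ≈ 0#

  -- An arc of a circle is the part of the circle in a closed half-plane
  -- whose boundary line cuts the circle at the two endpoints. Here `middle`
  -- lies in the plane of the circle and points towards the midpoint of the
  -- arc, and the arc consists of the points x of the circle with
  -- x ∙ middle ≥ p ∙ middle = q ∙ middle. For p ≠ q this gives exactly the
  -- arcs from p to q: shorter than, equal to or longer than π according to
  -- whether p ∙ middle is positive, zero or negative.
  record Arc (p q : S²) : Set (c ⊔ ℓ) where
    field
      circle     : GreatCircle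
      p-on       : p on circle
      q-on       : q on circle
      middle     : ℝ³
      nonzero    : NonZeroVector middle
      in-plane   : middle ∙ GreatCircle.normal circle ≈ 0#
      same-level : coords p ∙ middle ≈ coords q ∙ middle

  infix 4 _∈ₐ_
  _∈ₐ_ : ∀ {p q} → S² → Arc p q → Set ℓ
  _∈ₐ_ {p} x A = x on circle × coords p ∙ middle ≤ coords x ∙ middle
    where open Arc A

  -- Arcs of a drawing do not cross themselves, as their endpoints are
  -- distinct. Two edges with a common endpoint always share that point, so
  -- for them `meet-once` says that they meet only there.
  record GreatCircleThrackle (G : Graph) : Set (c ⊔ ℓ) where
    open Graph G
    field
      point          : Vertex → S²
      point-distinct : ∀ {u v} → u ≢ v → ¬ (point u ≈ₛ point v)
      arc            : (e : Edge) → Arc (point (src e)) (point (tgt e))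
      meet-once      : ∀ e f → endpoints e ≢ endpoints f →
                       ∃! _≈ₛ_ (λ x → x ∈ₐ arc e × x ∈ₐ arc f)

  record GeneralPosition {G : Graph} (D : GreatCircleThrackle G) : Set (c ⊔ ℓ) where
    open Graph G
    open GreatCircleThrackle D
    field
      no-three-on-circle : ∀ {u v w} → u ≢ v → v ≢ w → u ≢ w →
        ¬ (∃[ C ] (point u on C × point v on C × point w on C))
      no-antipodal       : ∀ u v → ¬ Antipodal (point u) (point v)

  GreatCircleThrackleable : Graph → Set (c ⊔ ℓ)
  GreatCircleThrackleable G = Σ (GreatCircleThrackle G) GeneralPosition

{-# OPTIONS --safe #-}

-- A tree that is not an augmented caterpillar contains a spider: a vertex o with three arms
-- o ~ a ~ b ~ c that are disjoint apart from o. (The vertex at distance at least 3 from the spine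
-- gives one arm, and the two halves of the spine, being at least as long, the others.)
--
-- A spider has no great-circle thrackle drawing in general position. Whether the arcs of two
-- disjoint edges p q and r s meet exactly once depends only on which of the two edges are
-- longer than π and on the signs of the determinants [p r s], [q r s], [p q r], [p q s]; two edges
-- with a common endpoint are not both longer than π. If all edges at o are short, the arm a, b, c
-- for which the circle through o and a separates the other two arms cannot be drawn. If o p is
-- long, with q following p on its arm, then p q and the other edges at o are short, and of
-- the two other arms the one that p q crosses last, counted from p, cannot be drawn.
--
-- Only the non-existence of a spider is needed of the drawing, so the signs may be chosen
-- classically, under a double negation, although the order of the reals is not decidable.
module Submission where

open import Defs

open import Algebra.Bundles using (CommutativeRing)
open import Data.Bool.Base using (Bool; true; false; T; _∧_; _∨_; not)
open import Data.Bool.Properties using (T?; T-∧; T-∨)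
open import Data.Empty using (⊥; ⊥-elim)
open import Data.Fin.Base as Fin using (Fin; zero; suc)
open import Data.Fin.Patterns
import Data.Fin.Properties as Finₚ
open import Data.Integer.Base as ℤ using (ℤ; -[1+_])
import Data.Integer.Properties as ℤₚ
open import Data.List.Base as List using (List; []; _∷_; _∷ʳ_; _++_; lookup)
open import Data.List.Membership.Propositional using (_∈_; _∉_)
open import Data.List.Membership.Propositional.Properties using (∈-lookup; ∈-++⁻)
import Data.List.Membership.DecPropositional as DecMembership
import Data.List.Properties as Listₚ
open import Data.List.Relation.Binary.Permutation.Propositional
  using (_↭_; prep; ↭-sym; ↭-trans; ↭-reflexive; ↭⇒↭ₛ)
open import Data.List.Relation.Binary.Permutation.Propositional.Properties
  using (shift; shifts; ++-comm; ++⁺ˡ; ↭-reverse; ∈-resp-↭)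
import Data.List.Relation.Binary.Permutation.Setoid.Properties as Permutationₛ
open import Data.List.Relation.Unary.All as All using ([]; _∷_)
open import Data.List.Relation.Unary.All.Properties using (¬Any⇒All¬)
open import Data.List.Relation.Unary.AllPairs using ([]; _∷_)
open import Data.List.Relation.Unary.Any using (here; there)
import Data.List.Relation.Unary.Unique.DecPropositional as DecUnique
open import Data.List.Relation.Unary.Unique.Propositional using (Unique)
open import Data.List.Relation.Unary.Unique.Propositional.Properties using (++⁺; map⁺)
open import Data.Maybe.Base as Maybe using (Maybe)
open import Data.Nat.Base as ℕ using (ℕ; zero; suc; z≤n; s≤s)
import Data.Nat.Properties as ℕₚ
open import Data.Product using (Σ; Σ-syntax; ∃; ∃-syntax; ∃₂; ∃!; _×_; _,_; proj₁; proj₂)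
open import Data.Sign.Base as Sign using (Sign; opposite)
open import Data.Sign.Properties using (s≢opposite[s]) renaming (_≟_ to _≟ˢ_)
open import Data.Sum.Base as Sum using (_⊎_; inj₁; inj₂)
open import Data.Vec.Functional using (Vector)
open import Effect.Monad using (RawMonad)
open import Function.Base using (_∘_; _$_)
open import Function.Bundles using (Equivalence)
open import Relation.Binary.Definitions using (tri<; tri≈; tri>)
open import Relation.Binary.PropositionalEquality as ≡ using (_≡_; _≢_)
open import Relation.Binary.Structures using (IsStrictPartialOrder)
open import Relation.Nullary.Decidable
  using (Dec; yes; no; True; False; toWitness; toWitnessFalse
        ; map′; _×-dec_; _→-dec_; ¬?; decidable-stable; dec⇒maybe)
open import Relation.Nullary.Negation using (¬¬-Monad)
open import Relation.Nullary.Negation.Core using (¬_; contradiction)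

-- A ring solver with integer coefficients.

module IntegerSolver {c ℓ} (R : CommutativeRing c ℓ) where
  open CommutativeRing R
  open import Algebra.Properties.Ring ring
    using (-0#≈0#; -‿involutive; -‿+-comm; -‿distribˡ-*; -‿distribʳ-*)
  open import Algebra.Properties.Semiring.Mult.TCOptimised semiring renaming (_×_ to _·_)
  open import Algebra.Solver.Ring.AlmostCommutativeRing
  open import Relation.Binary.Reasoning.Setoid setoid

  ⟦_⟧ᶻ : ℤ → Carrier
  ⟦ ℤ.+ n    ⟧ᶻ = n · 1#
  ⟦ -[1+ n ] ⟧ᶻ = - (suc n · 1#)

  neg-homo : ∀ i → ⟦ ℤ.- i ⟧ᶻ ≈ - ⟦ i ⟧ᶻ
  neg-homo (ℤ.+ zero)  = sym -0#≈0#
  neg-homo (ℤ.+ suc n) = refl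
  neg-homo -[1+ n ]    = sym (-‿involutive _)

  ⊖-homo : ∀ m n → ⟦ m ℤ.⊖ n ⟧ᶻ ≈ m · 1# - n · 1#
  ⊖-homo m zero = begin
    m · 1#         ≈⟨ +-identityʳ _ ⟨
    m · 1# + 0#    ≈⟨ +-congˡ -0#≈0# ⟨
    m · 1# - 0#    ∎
  ⊖-homo zero (suc n) = sym (+-identityˡ _)
  ⊖-homo (suc m) (suc n) = begin
    ⟦ suc m ℤ.⊖ suc n ⟧ᶻ                   ≡⟨ ≡.cong ⟦_⟧ᶻ (ℤₚ.[1+m]⊖[1+n]≡m⊖n m n) ⟩
    ⟦ m ℤ.⊖ n ⟧ᶻ                           ≈⟨ ⊖-homo m n ⟩
    m · 1# - n · 1#                        ≈⟨ +-identityˡ _ ⟨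
    0# + (m · 1# - n · 1#)                 ≈⟨ +-congʳ (-‿inverseʳ 1#) ⟨
    1# - 1# + (m · 1# - n · 1#)            ≈⟨ +-assoc 1# _ _ ⟩
    1# + (- 1# + (m · 1# - n · 1#))        ≈⟨ +-congˡ (+-assoc _ _ _) ⟨
    1# + (- 1# + m · 1# - n · 1#)          ≈⟨ +-congˡ (+-congʳ (+-comm _ _)) ⟩
    1# + (m · 1# - 1# - n · 1#)            ≈⟨ +-congˡ (+-assoc _ _ _) ⟩
    1# + (m · 1# + (- 1# - n · 1#))        ≈⟨ +-assoc 1# _ _ ⟨
    1# + m · 1# + (- 1# - n · 1#)          ≈⟨ +-cong (1+× m 1#) (trans (-‿cong (1+× n 1#)) (sym (-‿+-comm _ _))) ⟨
    suc m · 1# - suc n · 1#                ∎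

  +-homo : ∀ i j → ⟦ i ℤ.+ j ⟧ᶻ ≈ ⟦ i ⟧ᶻ + ⟦ j ⟧ᶻ
  +-homo (ℤ.+ m)  (ℤ.+ n)  = ×-homo-+ 1# m n
  +-homo (ℤ.+ m)  -[1+ n ] = ⊖-homo m (suc n)
  +-homo -[1+ m ] (ℤ.+ n)  = trans (⊖-homo n (suc m)) (+-comm _ _)
  +-homo -[1+ m ] -[1+ n ] = begin
    ⟦ -[1+ suc (m ℕ.+ n) ] ⟧ᶻ          ≈⟨ -‿cong (×-homo-+ 1# 1 (suc (m ℕ.+ n))) ⟩
    - (1# + suc (m ℕ.+ n) · 1#)        ≈⟨ -‿cong (+-congˡ (×-homo-+ 1# (suc m) n)) ⟩
    - (1# + (suc m · 1# + n · 1#))     ≈⟨ -‿cong (trans (sym (+-assoc _ _ _))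
                                            (trans (+-congʳ (+-comm _ _)) (+-assoc _ _ _))) ⟩
    - (suc m · 1# + (1# + n · 1#))     ≈⟨ -‿cong (+-congˡ (1+× n 1#)) ⟨
    - (suc m · 1# + suc n · 1#)        ≈⟨ -‿+-comm _ _ ⟨
    ⟦ -[1+ m ] ⟧ᶻ + ⟦ -[1+ n ] ⟧ᶻ      ∎

  -◃-homo : ∀ n → ⟦ Sign.- ℤ.◃ n ⟧ᶻ ≈ - (n · 1#)
  -◃-homo zero    = sym -0#≈0#
  -◃-homo (suc n) = refl

  *-homo : ∀ i j → ⟦ i ℤ.* j ⟧ᶻ ≈ ⟦ i ⟧ᶻ * ⟦ j ⟧ᶻ
  *-homo (ℤ.+ m) (ℤ.+ n) = begin
    ⟦ Sign.+ ℤ.◃ m ℕ.* n ⟧ᶻ      ≡⟨ ≡.cong ⟦_⟧ᶻ (ℤₚ.+◃n≡+n (m ℕ.* n)) ⟩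
    (m ℕ.* n) · 1#               ≈⟨ ×1-homo-* m n ⟩
    (m · 1#) * (n · 1#)          ∎
  *-homo (ℤ.+ m) -[1+ n ] = begin
    ⟦ Sign.- ℤ.◃ m ℕ.* suc n ⟧ᶻ  ≈⟨ -◃-homo (m ℕ.* suc n) ⟩
    - ((m ℕ.* suc n) · 1#)       ≈⟨ -‿cong (×1-homo-* m (suc n)) ⟩
    - ((m · 1#) * (suc n · 1#))  ≈⟨ -‿distribʳ-* _ _ ⟩
    (m · 1#) * - (suc n · 1#)    ∎
  *-homo -[1+ m ] (ℤ.+ n) = begin
    ⟦ Sign.- ℤ.◃ suc m ℕ.* n ⟧ᶻ  ≈⟨ -◃-homo (suc m ℕ.* n) ⟩
    - ((suc m ℕ.* n) · 1#)       ≈⟨ -‿cong (×1-homo-* (suc m) n) ⟩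
    - ((suc m · 1#) * (n · 1#))  ≈⟨ -‿distribˡ-* _ _ ⟩
    - (suc m · 1#) * (n · 1#)    ∎
  *-homo -[1+ m ] -[1+ n ] = begin
    (suc m ℕ.* suc n) · 1#             ≈⟨ ×1-homo-* (suc m) (suc n) ⟩
    (suc m · 1#) * (suc n · 1#)        ≈⟨ -‿involutive _ ⟨
    - - ((suc m · 1#) * (suc n · 1#))  ≈⟨ -‿cong (-‿distribˡ-* _ _) ⟩
    - (- (suc m · 1#) * (suc n · 1#))  ≈⟨ -‿distribʳ-* _ _ ⟩
    - (suc m · 1#) * - (suc n · 1#)    ∎

  ℤ⟶R : ℤ.+-*-rawRing -Raw-AlmostCommutative⟶ fromCommutativeRing R
  ℤ⟶R = record
    { ⟦_⟧ = ⟦_⟧ᶻ ; +-homo = +-homo ; *-homo = *-homo ; -‿homo = neg-homo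
    ; 0-homo = refl ; 1-homo = refl }

  -- Equality in the ring is not assumed decidable. Comparing the integers is enough: a failed
  -- comparison merely leaves two terms uncancelled.
  coefficients≟ : ∀ i j → Maybe (⟦ i ⟧ᶻ ≈ ⟦ j ⟧ᶻ)
  coefficients≟ i j = Maybe.map (λ i≡j → reflexive (≡.cong ⟦_⟧ᶻ i≡j)) (dec⇒maybe (i ℤₚ.≟ j))

  open import Algebra.Solver.Ring ℤ.+-*-rawRing (fromCommutativeRing R) ℤ⟶R coefficients≟ public

-- Signs in an ordered field

module OrderedField {c ℓ} (R : RealNumbers c ℓ) where
  open RealNumbers R
  open IntegerSolver commutativeRing
  open IsStrictPartialOrder <-isStrictPartialOrder public
    using (<-resp-≈) renaming (irrefl to <-irrefl; trans to <-trans; asym to <-asym)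

  <-respʳ : ∀ {x y z} → y ≈ z → x < y → x < z
  <-respʳ = proj₁ <-resp-≈

  <-respˡ : ∀ {x y z} → y ≈ z → y < x → z < x
  <-respˡ = proj₂ <-resp-≈

  <-resp : ∀ {x y z w} → x ≈ z → y ≈ w → x < y → z < w
  <-resp x≈z y≈w x<y = <-respˡ x≈z (<-respʳ y≈w x<y)

  -- By connexity an equation follows from two negations, so it may be proved classically.
  ≈-stable : ∀ {x y} → ¬ ¬ (x ≈ y) → x ≈ y
  ≈-stable ¬¬x≈y = <-connex
    (λ x<y → ¬¬x≈y λ x≈y → <-irrefl x≈y x<y)
    (λ y<x → ¬¬x≈y λ x≈y → <-irrefl (sym x≈y) y<x)

  0<y-x⇒x<y : ∀ {x y} → 0# < y - x → x < y
  0<y-x⇒x<y {x} {y} 0<y-x = <-resp (+-identityˡ x)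
    (solve 2 (λ x y → y :- x :+ x := y) refl x y) (+-monoˡ-< x 0<y-x)

  y-x<0⇒y<x : ∀ {x y} → y - x < 0# → y < x
  y-x<0⇒y<x {x} {y} y-x<0 = <-resp
    (solve 2 (λ x y → y :- x :+ x := y) refl x y) (+-identityˡ x) (+-monoˡ-< x y-x<0)

  HasSign : Sign → Carrier → Set ℓ
  HasSign Sign.+ x = 0# < x
  HasSign Sign.- x = x < 0#

  sign-resp : ∀ s {x y} → x ≈ y → HasSign s x → HasSign s y
  sign-resp Sign.+ = <-respʳ
  sign-resp Sign.- = <-respˡ

  sign⇒≉0 : ∀ s {x} → HasSign s x → ¬ (x ≈ 0#)
  sign⇒≉0 Sign.+ 0<x x≈0 = <-irrefl (sym x≈0) 0<x
  sign⇒≉0 Sign.- x<0 x≈0 = <-irrefl x≈0 x<0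

  sign-unique : ∀ s t {x} → HasSign s x → HasSign t x → s ≡ t
  sign-unique Sign.+ Sign.+ _ _ = ≡.refl
  sign-unique Sign.+ Sign.- p q = contradiction q (<-asym p)
  sign-unique Sign.- Sign.+ p q = contradiction q (<-asym p)
  sign-unique Sign.- Sign.- _ _ = ≡.refl

  -- Without trichotomy, connexity gives only this double negation. It is harmless wherever the goal
  -- is negative, an equation or decidable.
  ¬¬sign : ∀ {x} → ¬ (x ≈ 0#) → ¬ ¬ (∃[ s ] HasSign s x)
  ¬¬sign x≉0 ¬sign = x≉0 (<-connex
    (λ x<0 → ¬sign (Sign.- , x<0)) (λ 0<x → ¬sign (Sign.+ , 0<x)))

  sign-neg : ∀ s {x} → HasSign s x → HasSign (opposite s) (- x)
  sign-neg Sign.+ {x} 0<x = <-resp (+-identityˡ _) (-‿inverseʳ x) (+-monoˡ-< (- x) 0<x)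
  sign-neg Sign.- {x} x<0 = <-resp (-‿inverseʳ x) (+-identityˡ _) (+-monoˡ-< (- x) x<0)

  sign-* : ∀ s t {x y} → HasSign s x → HasSign t y → HasSign (s Sign.* t) (x * y)
  sign-* Sign.+ Sign.+ p q = *-pos p q
  sign-* Sign.+ Sign.- {x} {y} p q = <-respˡ
    (solve 2 (λ x y → :- (x :* :- y) := x :* y) refl x y)
    (sign-neg Sign.+ (*-pos p (sign-neg Sign.- q)))
  sign-* Sign.- Sign.+ {x} {y} p q = <-respˡ
    (solve 2 (λ x y → :- (:- x :* y) := x :* y) refl x y)
    (sign-neg Sign.+ (*-pos (sign-neg Sign.- p) q))
  sign-* Sign.- Sign.- {x} {y} p q = <-respʳ
    (solve 2 (λ x y → :- x :* :- y := x :* y) refl x y)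
    (*-pos (sign-neg Sign.- p) (sign-neg Sign.- q))

  sign-+ : ∀ s {x y} → HasSign s x → HasSign s y → HasSign s (x + y)
  sign-+ Sign.+ {x} {y} p q = <-trans q (<-respˡ (+-identityˡ y) (+-monoˡ-< y p))
  sign-+ Sign.- {x} {y} p q = <-trans (<-respʳ (+-identityˡ y) (+-monoˡ-< y p)) q

  -- As `x` is positive, any sign of `y` is also a sign of `x * y`, and signs are unique.
  sign-cancelˡ : ∀ s {x y} → 0# < x → HasSign s (x * y) → ¬ ¬ HasSign s y
  sign-cancelˡ s {x} {y} 0<x sgn ¬sgn = ¬¬sign y≉0 λ (t , sgn-y) →
    ¬sgn (≡.subst (λ s → HasSign s y) (sign-unique t s (sign-* Sign.+ t 0<x sgn-y) sgn) sgn-y)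
    where
    y≉0 : ¬ (y ≈ 0#)
    y≉0 y≈0 = sign⇒≉0 s sgn (trans (*-congˡ y≈0) (zeroʳ x))

  x*y≈0⇒y≈0 : ∀ {x y} → ¬ (x ≈ 0#) → x * y ≈ 0# → y ≈ 0#
  x*y≈0⇒y≈0 x≉0 xy≈0 = ≈-stable λ y≉0 →
    ¬¬sign x≉0 λ (s , sgn-x) → ¬¬sign y≉0 λ (t , sgn-y) →
    sign⇒≉0 (s Sign.* t) (sign-* s t sgn-x sgn-y) xy≈0

  ≤+<⇒0<+ : ∀ {x y} → 0# ≤ x → 0# < y → 0# < x + y
  ≤+<⇒0<+ {x} {y} 0≤x 0<y
    -- Being a negation, `0# ≤ x` allows no case split; instead `x < x + y` is compared with 0 by
    -- cotransitivity.
    with <-cotrans (<-resp (+-identityˡ x) (+-comm y x) (+-monoˡ-< x 0<y)) 0#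
  ... | inj₁ x<0   = contradiction x<0 0≤x
  ... | inj₂ 0<x+y = 0<x+y

  0≤x+y : ∀ {x y} → 0# ≤ x → 0# ≤ y → 0# ≤ x + y
  0≤x+y {x} {y} 0≤x 0≤y x+y<0 with <-cotrans x+y<0 x
  ... | inj₁ x+y<x = 0≤y (<-resp
    (solve 2 (λ x y → x :+ y :+ :- x := y) refl x y) (-‿inverseʳ x) (+-monoˡ-< (- x) x+y<x))
  ... | inj₂ x<0 = 0≤x x<0

  0≤x² : ∀ x → 0# ≤ x * x
  0≤x² x x²<0 = ¬¬sign (λ x≈0 → <-irrefl (trans (*-congˡ x≈0) (zeroʳ x)) x²<0)
    λ (s , sgn) → <-asym x²<0 (square s sgn)
    where
    square : ∀ s → HasSign s x → 0# < x * x
    square Sign.+ p = *-pos p p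
    square Sign.- p = sign-* Sign.- Sign.- p p

  x≉0⇒0<x² : ∀ {x} → ¬ (x ≈ 0#) → ¬ ¬ (0# < x * x)
  x≉0⇒0<x² {x} x≉0 0≮x² = x≉0 (x*y≈0⇒y≈0 x≉0 (<-connex (0≤x² x) 0≮x²))

-- Identities for cross products and determinants.

module Vectors {c ℓ} (R : RealNumbers c ℓ) where
  open RealNumbers R
  open OrderedField R
  open IntegerSolver commutativeRing
  open Sphere R
  open import Relation.Binary.Reasoning.Setoid setoid

  infix 8 _⊗_
  _⊗_ : ℝ³ → ℝ³ → ℝ³
  (x ⊗ y) 0F = x 1F * y 2F - x 2F * y 1F
  (x ⊗ y) 1F = x 2F * y 0F - x 0F * y 2F
  (x ⊗ y) 2F = x 0F * y 1F - x 1F * y 0F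

  det : ℝ³ → ℝ³ → ℝ³ → Carrier
  det x y z = x ∙ y ⊗ z

  -- The same operations on vectors of polynomials, for the ring solver.
  module Poly {n : ℕ} where
    ⟨_,_,_⟩ : (a b c : Polynomial n) → Vector (Polynomial n) 3
    ⟨ a , b , c ⟩ 0F = a
    ⟨ a , b , c ⟩ 1F = b
    ⟨ a , b , c ⟩ 2F = c

    _:∙_ : (x y : Vector (Polynomial n) 3) → Polynomial n
    -- The final zero is the value of `sum` on the empty vector; with it the polynomial evaluates to
    -- `_∙_` itself.
    x :∙ y = x 0F :* y 0F :+ (x 1F :* y 1F :+ (x 2F :* y 2F :+ con ℤ.0ℤ))

    _:⊗_ : (x y : Vector (Polynomial n) 3) → Vector (Polynomial n) 3
    (x :⊗ y) 0F = x 1F :* y 2F :- x 2F :* y 1F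
    (x :⊗ y) 1F = x 2F :* y 0F :- x 0F :* y 2F
    (x :⊗ y) 2F = x 0F :* y 1F :- x 1F :* y 0F

    :det : (x y z : Vector (Polynomial n) 3) → Polynomial n
    :det x y z = x :∙ (y :⊗ z)
  open Poly

  det-cyclic : ∀ x y z → det x y z ≈ det y z x
  det-cyclic x y z = solve 9 (λ a b c d e f g h i →
    let x = ⟨ a , b , c ⟩ ; y = ⟨ d , e , f ⟩ ; z = ⟨ g , h , i ⟩ in
    :det x y z := :det y z x) refl
    (x 0F) (x 1F) (x 2F) (y 0F) (y 1F) (y 2F) (z 0F) (z 1F) (z 2F)

  det-swap : ∀ x y z → det x z y ≈ - det x y z
  det-swap x y z = solve 9 (λ a b c d e f g h i →
    let x = ⟨ a , b , c ⟩ ; y = ⟨ d , e , f ⟩ ; z = ⟨ g , h , i ⟩ in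
    :det x z y := :- :det x y z) refl
    (x 0F) (x 1F) (x 2F) (y 0F) (y 1F) (y 2F) (z 0F) (z 1F) (z 2F)

  det-first≈0 : ∀ x y → x ∙ x ⊗ y ≈ 0#
  det-first≈0 x y = solve 6 (λ a b c d e f →
    let x = ⟨ a , b , c ⟩ ; y = ⟨ d , e , f ⟩ in :det x x y := con ℤ.0ℤ) refl
    (x 0F) (x 1F) (x 2F) (y 0F) (y 1F) (y 2F)

  det-second≈0 : ∀ x y → y ∙ x ⊗ y ≈ 0#
  det-second≈0 x y = solve 6 (λ a b c d e f →
    let x = ⟨ a , b , c ⟩ ; y = ⟨ d , e , f ⟩ in :det y x y := con ℤ.0ℤ) refl
    (x 0F) (x 1F) (x 2F) (y 0F) (y 1F) (y 2F)

  module _ {n : ℕ} (x y z w : Vector (Polynomial n) 3) where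
    :cramer : Fin 3 → Polynomial n × Polynomial n
    :cramer i = :- :det y z w :* x i :+ :det x z w :* y i := :det x y w :* z i :- :det x y z :* w i

  -- Both sides expand (x ⊗ y) ⊗ (z ⊗ w), which lies in the plane of x, y and in that of z, w. This
  -- gives the coordinates of a common point of two great circles with respect to either pair of
  -- ends.
  cramer : ∀ x y z w i →
    - det y z w * x i + det x z w * y i ≈ det x y w * z i - det x y z * w i
  cramer x y z w 0F = solve 12 (λ a b c d e f g h i j k l →
    :cramer ⟨ a , b , c ⟩ ⟨ d , e , f ⟩ ⟨ g , h , i ⟩ ⟨ j , k , l ⟩ 0F) refl
    (x 0F) (x 1F) (x 2F) (y 0F) (y 1F) (y 2F) (z 0F) (z 1F) (z 2F) (w 0F) (w 1F) (w 2F)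
  cramer x y z w 1F = solve 12 (λ a b c d e f g h i j k l →
    :cramer ⟨ a , b , c ⟩ ⟨ d , e , f ⟩ ⟨ g , h , i ⟩ ⟨ j , k , l ⟩ 1F) refl
    (x 0F) (x 1F) (x 2F) (y 0F) (y 1F) (y 2F) (z 0F) (z 1F) (z 2F) (w 0F) (w 1F) (w 2F)
  cramer x y z w 2F = solve 12 (λ a b c d e f g h i j k l →
    :cramer ⟨ a , b , c ⟩ ⟨ d , e , f ⟩ ⟨ g , h , i ⟩ ⟨ j , k , l ⟩ 2F) refl
    (x 0F) (x 1F) (x 2F) (y 0F) (y 1F) (y 2F) (z 0F) (z 1F) (z 2F) (w 0F) (w 1F) (w 2F)

  -- The three-term relation. Later only its consequence for signs matters: three nonzero terms with
  -- sum zero do not all have the same sign.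
  grassmann-plücker : ∀ a b c d e →
    det a b c * det a d e + - (det a b d * det a c e) + det a b e * det a c d ≈ 0#
  grassmann-plücker a b c d e = solve 15 (λ a₀ a₁ a₂ b₀ b₁ b₂ c₀ c₁ c₂ d₀ d₁ d₂ e₀ e₁ e₂ →
    let a = ⟨ a₀ , a₁ , a₂ ⟩ ; b = ⟨ b₀ , b₁ , b₂ ⟩ ; c = ⟨ c₀ , c₁ , c₂ ⟩
        d = ⟨ d₀ , d₁ , d₂ ⟩ ; e = ⟨ e₀ , e₁ , e₂ ⟩ in
    :det a b c :* :det a d e :+ :- (:det a b d :* :det a c e) :+ :det a b e :* :det a c d
      := con ℤ.0ℤ) refl
    (a 0F) (a 1F) (a 2F) (b 0F) (b 1F) (b 2F) (c 0F) (c 1F) (c 2F)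
    (d 0F) (d 1F) (d 2F) (e 0F) (e 1F) (e 2F)

-- Arcs and crossings in terms of signs

-- An arc from p to q has sign ε = + if it is shorter than π and - if it is longer. A point on its
-- circle is a positive multiple of α p + β q; it lies on the short arc if α and β are both
-- positive, and on the long arc otherwise. Only the signs of α, β ≠ 0 matter.
both : Sign → Sign → Sign
both Sign.+ Sign.+ = Sign.+
both _      _      = Sign.-

inside : Sign → Sign → Sign → Sign
inside ε α β = both α β Sign.* ε

positive : Sign → Bool
positive Sign.+ = true
positive Sign.- = false

-- α, β are the coordinates of a point with respect to the ends of the first arc, and γ, δ with
-- respect to the ends of the second.
meets : (ε₁ ε₂ α β γ δ : Sign) → Bool
meets ε₁ ε₂ α β γ δ = positive (inside ε₁ α β) ∧ positive (inside ε₂ γ δ)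

-- Two great circles meet in a point and its antipode; here only the given one is on both arcs.
meetsOnce : (ε₁ ε₂ α β γ δ : Sign) → Bool
meetsOnce ε₁ ε₂ α β γ δ = meets ε₁ ε₂ α β γ δ
  ∧ not (meets ε₁ ε₂ (opposite α) (opposite β) (opposite γ) (opposite δ))

-- The circles p q and r s meet in ± (- [q r s] p + [p r s] q) = ± ([p q s] r - [p q r] s).
Crosses : (ε₁ ε₂ prs qrs pqr pqs : Sign) → Set
Crosses ε₁ ε₂ prs qrs pqr pqs = T
  (meetsOnce ε₁ ε₂ (opposite qrs) prs pqs (opposite pqr)
  ∨ meetsOnce ε₁ ε₂ qrs (opposite prs) (opposite pqs) pqr)

-- Points on a great-circle arc.

module Circles {c ℓ} (R : RealNumbers c ℓ) where
  open RealNumbers R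
  open OrderedField R
  open Vectors R
  open IntegerSolver commutativeRing
  open Sphere R
  open Poly
  open import Relation.Binary.Reasoning.Setoid setoid

  ∙-congˡ : ∀ {x y} z → (∀ i → x i ≈ y i) → x ∙ z ≈ y ∙ z
  ∙-congˡ z x≈y = +-cong (*-congʳ (x≈y 0F)) (+-cong (*-congʳ (x≈y 1F)) (+-congʳ (*-congʳ (x≈y 2F))))

  ∙-comm : ∀ x y → x ∙ y ≈ y ∙ x
  ∙-comm x y = solve 6 (λ a b c d e f →
    ⟨ a , b , c ⟩ :∙ ⟨ d , e , f ⟩ := ⟨ d , e , f ⟩ :∙ ⟨ a , b , c ⟩) refl
    (x 0F) (x 1F) (x 2F) (y 0F) (y 1F) (y 2F)

  scale-∙ : ∀ s x y → (λ i → s * x i) ∙ y ≈ s * (x ∙ y)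
  scale-∙ s x y = solve 7 (λ s a b c d e f →
    ⟨ s :* a , s :* b , s :* c ⟩ :∙ ⟨ d , e , f ⟩ := s :* (⟨ a , b , c ⟩ :∙ ⟨ d , e , f ⟩)) refl
    s (x 0F) (x 1F) (x 2F) (y 0F) (y 1F) (y 2F)

  combination-∙ : ∀ s t x y z → (λ i → s * x i + t * y i) ∙ z ≈ s * (x ∙ z) + t * (y ∙ z)
  combination-∙ s t x y z = solve 11 (λ s t a b c d e f g h i →
    let x = ⟨ a , b , c ⟩ ; y = ⟨ d , e , f ⟩ ; z = ⟨ g , h , i ⟩ in
    ⟨ s :* a :+ t :* d , s :* b :+ t :* e , s :* c :+ t :* f ⟩ :∙ z := s :* (x :∙ z) :+ t :* (y :∙ z)) refl
    s t (x 0F) (x 1F) (x 2F) (y 0F) (y 1F) (y 2F) (z 0F) (z 1F) (z 2F)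

  neg-∙ : ∀ x y → (λ i → - x i) ∙ y ≈ - (x ∙ y)
  neg-∙ x y = solve 6 (λ a b c d e f →
    ⟨ :- a , :- b , :- c ⟩ :∙ ⟨ d , e , f ⟩ := :- (⟨ a , b , c ⟩ :∙ ⟨ d , e , f ⟩)) refl
    (x 0F) (x 1F) (x 2F) (y 0F) (y 1F) (y 2F)

  nonzero⇒0<norm² : ∀ x → NonZeroVector x → ¬ ¬ (0# < x ∙ x)
  nonzero⇒0<norm² x x≉0 0≮xx = x≉0 λ i → ≈-stable λ xᵢ≉0 → x≉0⇒0<x² xᵢ≉0 (0≮xx ∘ 0<norm² i)
    where
    0≤x₂²+0 : 0# ≤ x 2F * x 2F + 0#
    0≤x₂²+0 = 0≤x² (x 2F) ∘ <-respˡ (+-identityʳ _)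

    0<norm² : ∀ i → 0# < x i * x i → 0# < x ∙ x
    0<norm² 0F 0<x₀² = <-respʳ (+-comm _ _)
      (≤+<⇒0<+ (0≤x+y (0≤x² (x 1F)) 0≤x₂²+0) 0<x₀²)
    0<norm² 1F 0<x₁² = ≤+<⇒0<+ (0≤x² (x 0F)) (<-respʳ (+-comm _ _) (≤+<⇒0<+ 0≤x₂²+0 0<x₁²))
    0<norm² 2F 0<x₂² = ≤+<⇒0<+ (0≤x² (x 0F))
      (≤+<⇒0<+ (0≤x² (x 1F)) (<-respʳ (sym (+-identityʳ _)) 0<x₂²))

  0<norm²⇒nonzero : ∀ x → 0# < x ∙ x → NonZeroVector x
  0<norm²⇒nonzero x 0<xx x≈0 = <-irrefl (sym (trans (∙-congˡ x x≈0) (solve 3 (λ a b c →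
    ⟨ con ℤ.0ℤ , con ℤ.0ℤ , con ℤ.0ℤ ⟩ :∙ ⟨ a , b , c ⟩ := con ℤ.0ℤ) refl (x 0F) (x 1F) (x 2F)))) 0<xx

  0<2 : 0# < 1# + 1#
  0<2 = sign-+ Sign.+ 0<1 0<1

  -- The vector [x y z] n equals (x ∙ n) y ⊗ z + (y ∙ n) z ⊗ x + (z ∙ n) x ⊗ y; its product with n
  -- shows that (n ∙ n) [x y z] vanishes.
  orthogonal⇒coplanar : ∀ n x y z → NonZeroVector n → x ∙ n ≈ 0# → y ∙ n ≈ 0# → z ∙ n ≈ 0# → det x y z ≈ 0#
  orthogonal⇒coplanar n x y z n≉0 xn yn zn = ≈-stable λ d≉0 → nonzero⇒0<norm² n n≉0 λ 0<nn →
    d≉0 $ x*y≈0⇒y≈0 (sign⇒≉0 Sign.+ 0<nn) $ begin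
      (n ∙ n) * det x y z
        ≈⟨ solve 12 (λ a b c d e f g h i j k l →
             let x = ⟨ a , b , c ⟩ ; y = ⟨ d , e , f ⟩ ; z = ⟨ g , h , i ⟩ ; n = ⟨ j , k , l ⟩ in
             (n :∙ n) :* :det x y z
               := (x :∙ n) :* :det n y z :+ (y :∙ n) :* :det n z x :+ (z :∙ n) :* :det n x y) refl
             (x 0F) (x 1F) (x 2F) (y 0F) (y 1F) (y 2F) (z 0F) (z 1F) (z 2F) (n 0F) (n 1F) (n 2F) ⟩
      (x ∙ n) * det n y z + (y ∙ n) * det n z x + (z ∙ n) * det n x y
        ≈⟨ +-cong (+-cong (*-congʳ xn) (*-congʳ yn)) (*-congʳ zn) ⟩
      0# * det n y z + 0# * det n z x + 0# * det n x y
        ≈⟨ solve 3 (λ a b c → con ℤ.0ℤ :* a :+ con ℤ.0ℤ :* b :+ con ℤ.0ℤ :* c := con ℤ.0ℤ) refl _ _ _ ⟩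
      0# ∎

  module _ {u v : ℝ³} (uu : u ∙ u ≈ 1#) (vv : v ∙ v ≈ 1#) where
    -- For unit vectors | u - v |² = 2 (1 - u ∙ v).
    distinct⇒uv<1 : ¬ (∀ i → u i ≈ v i) → ¬ ¬ (0# < 1# - u ∙ v)
    distinct⇒uv<1 u≉v ¬uv<1 = nonzero⇒0<norm² w
      (λ w≈0 → u≉v λ i → trans (solve 2 (λ a b → a := a :- b :+ b) refl (u i) (v i))
                               (trans (+-congʳ (w≈0 i)) (+-identityˡ _)))
      λ 0<ww → sign-cancelˡ Sign.+ 0<2 (<-respʳ ww≈ 0<ww) ¬uv<1
      where
      w : ℝ³
      w i = u i - v i
      ww≈ : w ∙ w ≈ (1# + 1#) * (1# - u ∙ v)
      ww≈ = begin
        w ∙ w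
          ≈⟨ solve 6 (λ a b c d e f →
               let u = ⟨ a , b , c ⟩ ; v = ⟨ d , e , f ⟩ ; w = ⟨ a :- d , b :- e , c :- f ⟩ in
               w :∙ w := u :∙ u :+ v :∙ v :- (u :∙ v :+ u :∙ v)) refl
               (u 0F) (u 1F) (u 2F) (v 0F) (v 1F) (v 2F) ⟩
        u ∙ u + v ∙ v - (u ∙ v + u ∙ v)
          ≈⟨ +-congʳ (+-cong uu vv) ⟩
        1# + 1# - (u ∙ v + u ∙ v)
          ≈⟨ solve 1 (λ a → con ℤ.1ℤ :+ con ℤ.1ℤ :- (a :+ a)
               := (con ℤ.1ℤ :+ con ℤ.1ℤ) :* (con ℤ.1ℤ :- a)) refl (u ∙ v) ⟩
        (1# + 1#) * (1# - u ∙ v) ∎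

  -- By Lagrange's identity | u ⊗ v |² = (1 - u ∙ v) (1 + u ∙ v). Both factors are positive, the
  -- second by `distinct⇒uv<1` for u and - v.
  independent : ∀ {u v} → u ∙ u ≈ 1# → v ∙ v ≈ 1# →
    ¬ (∀ i → u i ≈ v i) → ¬ (∀ i → u i ≈ - v i) → ¬ ¬ (0# < u ⊗ v ∙ u ⊗ v)
  independent {u} {v} uu vv u≉v u≉-v ¬uv =
    distinct⇒uv<1 uu vv u≉v λ p →
    distinct⇒uv<1 uu (trans (solve 3 (λ a b c → ⟨ :- a , :- b , :- c ⟩ :∙ ⟨ :- a , :- b , :- c ⟩
        := ⟨ a , b , c ⟩ :∙ ⟨ a , b , c ⟩) refl (v 0F) (v 1F) (v 2F)) vv) u≉-v λ q →
    ¬uv $ <-respʳ (begin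
      (1# - u ∙ v) * (1# - u ∙ (λ i → - v i))
        ≈⟨ solve 6 (λ a b c d e f →
               let u = ⟨ a , b , c ⟩ ; v = ⟨ d , e , f ⟩ ; w = ⟨ :- d , :- e , :- f ⟩ in
               (con ℤ.1ℤ :- u :∙ v) :* (con ℤ.1ℤ :- u :∙ w)
               := con ℤ.1ℤ :* con ℤ.1ℤ :- (u :∙ v) :* (u :∙ v)) refl
               (u 0F) (u 1F) (u 2F) (v 0F) (v 1F) (v 2F) ⟩
      1# * 1# - (u ∙ v) * (u ∙ v)
        ≈⟨ +-congʳ (*-cong uu vv) ⟨
      (u ∙ u) * (v ∙ v) - (u ∙ v) * (u ∙ v)
        ≈⟨ solve 6 (λ a b c d e f →
               let u = ⟨ a , b , c ⟩ ; v = ⟨ d , e , f ⟩ in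
               (u :∙ u) :* (v :∙ v) :- (u :∙ v) :* (u :∙ v) := (u :⊗ v) :∙ (u :⊗ v)) refl
               (u 0F) (u 1F) (u 2F) (v 0F) (v 1F) (v 2F) ⟩
      u ⊗ v ∙ u ⊗ v ∎) (*-pos p q)

  -- For unit vectors p, q with p ∙ q = k and μ = | α p + β q |, this compares α + β with μ, through
  -- (α + β)² - μ² = 2 α β (1 - k).
  span-sign : ∀ s t {α β μ k} → HasSign s α → HasSign t β → 0# < μ → 0# < 1# - k →
    μ * μ ≈ α * α + β * β + (1# + 1#) * (α * β) * k →
    ¬ ¬ HasSign (both s t) (α + β - μ)
  span-sign s t {α} {β} {μ} {k} sα sβ 0<μ k<1 μμ = cases s t sα sβ product-sign
    where
    X = α + β - μ
    Y = α + β + μ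
    YX≈ : Y * X ≈ (1# + 1#) * ((α * β) * (1# - k))
    YX≈ = begin
      Y * X                            ≈⟨ solve 3 (λ α β μ → (α :+ β :+ μ) :* (α :+ β :- μ)
                                            := (α :+ β) :* (α :+ β) :- μ :* μ) refl α β μ ⟩
      (α + β) * (α + β) - μ * μ        ≈⟨ +-congˡ (-‿cong μμ) ⟩
      (α + β) * (α + β) - (α * α + β * β + (1# + 1#) * (α * β) * k)
        ≈⟨ solve 3 (λ α β k → let two = con ℤ.1ℤ :+ con ℤ.1ℤ in
             (α :+ β) :* (α :+ β) :- (α :* α :+ β :* β :+ two :* (α :* β) :* k)
             := two :* ((α :* β) :* (con ℤ.1ℤ :- k))) refl α β k ⟩
      (1# + 1#) * ((α * β) * (1# - k)) ∎

    product-sign : HasSign (s Sign.* t Sign.* Sign.+) (Y * X)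
    product-sign = sign-resp (s Sign.* t Sign.* Sign.+) (sym YX≈)
      (sign-* Sign.+ (s Sign.* t Sign.* Sign.+) 0<2
        (sign-* (s Sign.* t) Sign.+ (sign-* s t sα sβ) k<1))

    -- If X were positive, then so would be Y = X + 2 μ, and hence the product.
    opposite-signs : HasSign Sign.- (Y * X) → ¬ ¬ (X < 0#)
    opposite-signs YX<0 X≮0 = ¬¬sign
      (λ X≈0 → sign⇒≉0 Sign.- YX<0 (trans (*-congˡ X≈0) (zeroʳ Y)))
      λ where
        (Sign.- , X<0) → X≮0 X<0
        (Sign.+ , 0<X) → <-asym YX<0 (*-pos (<-respʳ
          (solve 3 (λ α β μ → α :+ β :- μ :+ (μ :+ μ) := α :+ β :+ μ) refl α β μ)
          (sign-+ Sign.+ 0<X (sign-+ Sign.+ 0<μ 0<μ))) 0<X)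

    cases : ∀ s t → HasSign s α → HasSign t β → HasSign (s Sign.* t Sign.* Sign.+) (Y * X) →
            ¬ ¬ HasSign (both s t) X
    cases Sign.+ Sign.+ p q r = sign-cancelˡ Sign.+ (sign-+ Sign.+ (sign-+ Sign.+ p q) 0<μ) r
    cases Sign.+ Sign.- p q r = opposite-signs r
    cases Sign.- Sign.+ p q r = opposite-signs r
    cases Sign.- Sign.- p q r = contradiction
      (sign-+ Sign.- (sign-+ Sign.- p q) (sign-neg Sign.+ 0<μ))

  module _ {p q : S²} (A : Arc p q) where
    open Arc A

    -- With u = p, v = q and m the middle vector, | u ⊗ v |² | m |² = [u v m]² + | (u ⊗ v) ⊗ m |².
    level≉0 : ¬ p ≈ₛ q → ¬ Antipodal p q → ¬ (coords p ∙ middle ≈ 0#)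
    level≉0 p≉q p≉-q pm = independent (proj₂ p) (proj₂ q) p≉q p≉-q λ 0<pq →
      nonzero⇒0<norm² m nonzero λ 0<mm → sign⇒≉0 Sign.+ (*-pos 0<pq 0<mm) (begin
        (u ⊗ v ∙ u ⊗ v) * (m ∙ m)
          ≈⟨ solve 9 (λ a b c d e f g h i →
              let u = ⟨ a , b , c ⟩ ; v = ⟨ d , e , f ⟩ ; m = ⟨ g , h , i ⟩ in
              ((u :⊗ v) :∙ (u :⊗ v)) :* (m :∙ m) := :det u v m :* :det u v m
                :+ ((u :∙ m) :* ((u :∙ m) :* (v :∙ v) :- (v :∙ m) :* (u :∙ v) :- (v :∙ m) :* (u :∙ v))
                   :+ (v :∙ m) :* ((v :∙ m) :* (u :∙ u)))) refl
              (u 0F) (u 1F) (u 2F) (v 0F) (v 1F) (v 2F) (m 0F) (m 1F) (m 2F) ⟩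
        det u v m * det u v m
          + ((u ∙ m) * ((u ∙ m) * (v ∙ v) - (v ∙ m) * (u ∙ v) - (v ∙ m) * (u ∙ v))
            + (v ∙ m) * ((v ∙ m) * (u ∙ u)))
          ≈⟨ +-cong (*-congʳ (orthogonal⇒coplanar normal u v m (GreatCircle.nonzero circle) p-on q-on in-plane))
               (+-cong (*-congʳ pm) (*-congʳ (trans (sym same-level) pm))) ⟩
        0# * det u v m
          + (0# * ((u ∙ m) * (v ∙ v) - (v ∙ m) * (u ∙ v) - (v ∙ m) * (u ∙ v))
            + 0# * ((v ∙ m) * (u ∙ u)))
          ≈⟨ solve 3 (λ a b c → con ℤ.0ℤ :* a :+ (con ℤ.0ℤ :* b :+ con ℤ.0ℤ :* c) := con ℤ.0ℤ) refl _ _ _ ⟩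
        0# ∎)
      where
      u = coords p
      v = coords q
      m = middle
      open GreatCircle circle using (normal)

    -- Both ends have the same level t = p ∙ m, so μ (z ∙ m - t) = (α + β - μ) t. The sign of t is
    -- ε, and that of the other factor comes from `span-sign`, where | z | = 1 supplies the formula
    -- for μ².
    inside-sign : ∀ ε s t {α β μ} (z : S²) → HasSign ε (coords p ∙ middle) →
      0# < 1# - coords p ∙ coords q → HasSign s α → HasSign t β → 0# < μ →
      (∀ i → μ * coords z i ≈ α * coords p i + β * coords q i) →
      ¬ ¬ HasSign (inside ε s t) (coords z ∙ middle - coords p ∙ middle)
    inside-sign ε s t {α} {β} {μ} (z , zz) sε pq<1 sα sβ 0<μ μz≈ ¬sgn =
      span-sign s t sα sβ 0<μ pq<1 μμ≈ λ sX →
      sign-cancelˡ (inside ε s t) 0<μ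
        (sign-resp (inside ε s t) (sym μt≈) (sign-* (both s t) ε sX sε)) ¬sgn
      where
      u = coords p
      v = coords q
      m = middle
      expand : ∀ y → μ * (z ∙ y) ≈ α * (u ∙ y) + β * (v ∙ y)
      expand y = trans (sym (scale-∙ μ z y)) (trans (∙-congˡ y μz≈) (combination-∙ α β u v y))

      μμ≈ : μ * μ ≈ α * α + β * β + (1# + 1#) * (α * β) * (u ∙ v)
      μμ≈ = begin
        μ * μ                               ≈⟨ *-congˡ (*-identityʳ μ) ⟨
        μ * (μ * 1#)                        ≈⟨ *-congˡ (*-congˡ zz) ⟨
        μ * (μ * (z ∙ z))                   ≈⟨ *-congˡ (expand z) ⟩
        μ * (α * (u ∙ z) + β * (v ∙ z))     ≈⟨ *-congˡ (+-cong (*-congˡ (∙-comm u z)) (*-congˡ (∙-comm v z))) ⟩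
        μ * (α * (z ∙ u) + β * (z ∙ v))
          ≈⟨ solve 5 (λ m a b x y → m :* (a :* x :+ b :* y) := a :* (m :* x) :+ b :* (m :* y)) refl μ α β _ _ ⟩
        α * (μ * (z ∙ u)) + β * (μ * (z ∙ v)) ≈⟨ +-cong (*-congˡ (expand u)) (*-congˡ (expand v)) ⟩
        α * (α * (u ∙ u) + β * (v ∙ u)) + β * (α * (u ∙ v) + β * (v ∙ v))
          ≈⟨ +-cong
               (*-congˡ (+-cong (*-congˡ (proj₂ p)) (*-congˡ (∙-comm v u))))
               (*-congˡ (+-congˡ (*-congˡ (proj₂ q)))) ⟩
        α * (α * 1# + β * (u ∙ v)) + β * (α * (u ∙ v) + β * 1#)
          ≈⟨ solve 3 (λ a b k → a :* (a :* con ℤ.1ℤ :+ b :* k) :+ b :* (a :* k :+ b :* con ℤ.1ℤ)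
               := a :* a :+ b :* b :+ (con ℤ.1ℤ :+ con ℤ.1ℤ) :* (a :* b) :* k) refl α β (u ∙ v) ⟩
        α * α + β * β + (1# + 1#) * (α * β) * (u ∙ v) ∎

      μt≈ : μ * (z ∙ m - u ∙ m) ≈ (α + β - μ) * (u ∙ m)
      μt≈ = begin
        μ * (z ∙ m - u ∙ m)
          ≈⟨ solve 3 (λ m x y → m :* (x :- y) := m :* x :- m :* y) refl μ _ _ ⟩
        μ * (z ∙ m) - μ * (u ∙ m)                ≈⟨ +-congʳ (expand m) ⟩
        α * (u ∙ m) + β * (v ∙ m) - μ * (u ∙ m)  ≈⟨ +-congʳ (+-congˡ (*-congˡ same-level)) ⟨
        α * (u ∙ m) + β * (u ∙ m) - μ * (u ∙ m)
          ≈⟨ solve 4 (λ a b m x → a :* x :+ b :* x :- m :* x := (a :+ b :- m) :* x) refl α β μ _ ⟩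
        (α + β - μ) * (u ∙ m) ∎

    ∈ₐ⇒positive : ∀ s x → HasSign s (coords x ∙ middle - coords p ∙ middle) → x ∈ₐ A → T (positive s)
    ∈ₐ⇒positive Sign.+ x _   _           = _
    ∈ₐ⇒positive Sign.- x x<p (_ , p≤x) = contradiction (y-x<0⇒y<x x<p) p≤x

    positive⇒∈ₐ : ∀ s x → HasSign s (coords x ∙ middle - coords p ∙ middle) → x on circle →
      T (positive s) → x ∈ₐ A
    positive⇒∈ₐ Sign.+ x p<x x-on _ = x-on , <-asym (0<y-x⇒x<y p<x)

  antipode : S² → S²
  antipode (x , xx) = (λ i → - x i) , trans (solve 3 (λ a b c →
    ⟨ :- a , :- b , :- c ⟩ :∙ ⟨ :- a , :- b , :- c ⟩ := ⟨ a , b , c ⟩ :∙ ⟨ a , b , c ⟩) refl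
    (x 0F) (x 1F) (x 2F)) xx

  antipode-on : ∀ x C → x on C → antipode x on C
  antipode-on x C x-on = trans (neg-∙ (coords x) normal)
    (trans (-‿cong x-on) (solve 0 (:- con ℤ.0ℤ := con ℤ.0ℤ) refl))
    where open GreatCircle C

  x≉antipode : ∀ x → ¬ x ≈ₛ antipode x
  x≉antipode (x , xx) x≈-x = <-irrefl (sym (begin
    1# + 1#        ≈⟨ +-congˡ xx ⟨
    1# + x ∙ x     ≈⟨ +-congˡ (∙-congˡ x x≈-x) ⟩
    1# + (λ i → - x i) ∙ x ≈⟨ +-congˡ (neg-∙ x x) ⟩
    1# - x ∙ x     ≈⟨ +-congˡ (-‿cong xx) ⟩
    1# - 1#        ≈⟨ -‿inverseʳ 1# ⟩
    0# ∎)) 0<2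

T-not : ∀ {b} → ¬ T b → T (not b)
T-not {false} _  = _
T-not {true}  ¬t = ¬t _

-- The crossing condition for two arcs.

module Crossing {c ℓ} (R : RealNumbers c ℓ) where
  open RealNumbers R
  open OrderedField R
  open Vectors R
  open Circles R
  open IntegerSolver commutativeRing
  open Sphere R
  open Poly
  open import Relation.Binary.Reasoning.Setoid setoid

  module _ {n : ℕ} (z p q r s : Vector (Polynomial n) 3) where
    :w : Vector (Polynomial n) 3
    :w i = :- :det q r s :* p i :+ :det p r s :* q i

    :parallel : Fin 3 → Polynomial n × Polynomial n
    :parallel i = (z :∙ z) :* :w i
      := (z :∙ :w) :* z i :+ (:det z p q :* (z :⊗ (r :⊗ s)) i :- :det z r s :* (z :⊗ (p :⊗ q)) i)

  -- With a = p ⊗ q and b = r ⊗ s the vector w below is a ⊗ b, and z ⊗ (w ⊗ z) is expanded in two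
  -- ways; so a unit vector z orthogonal to a and b satisfies w = (z ∙ w) z.
  parallel : ∀ z p q r s i → let w = λ i → - det q r s * p i + det p r s * q i in
    (z ∙ z) * w i ≈ (z ∙ w) * z i + (det z p q * (z ⊗ (r ⊗ s)) i - det z r s * (z ⊗ (p ⊗ q)) i)
  parallel z p q r s 0F = solve 15 (λ z₀ z₁ z₂ p₀ p₁ p₂ q₀ q₁ q₂ r₀ r₁ r₂ s₀ s₁ s₂ →
    :parallel ⟨ z₀ , z₁ , z₂ ⟩ ⟨ p₀ , p₁ , p₂ ⟩ ⟨ q₀ , q₁ , q₂ ⟩ ⟨ r₀ , r₁ , r₂ ⟩ ⟨ s₀ , s₁ , s₂ ⟩ 0F) refl
    (z 0F) (z 1F) (z 2F) (p 0F) (p 1F) (p 2F) (q 0F) (q 1F) (q 2F)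
    (r 0F) (r 1F) (r 2F) (s 0F) (s 1F) (s 2F)
  parallel z p q r s 1F = solve 15 (λ z₀ z₁ z₂ p₀ p₁ p₂ q₀ q₁ q₂ r₀ r₁ r₂ s₀ s₁ s₂ →
    :parallel ⟨ z₀ , z₁ , z₂ ⟩ ⟨ p₀ , p₁ , p₂ ⟩ ⟨ q₀ , q₁ , q₂ ⟩ ⟨ r₀ , r₁ , r₂ ⟩ ⟨ s₀ , s₁ , s₂ ⟩ 1F) refl
    (z 0F) (z 1F) (z 2F) (p 0F) (p 1F) (p 2F) (q 0F) (q 1F) (q 2F)
    (r 0F) (r 1F) (r 2F) (s 0F) (s 1F) (s 2F)
  parallel z p q r s 2F = solve 15 (λ z₀ z₁ z₂ p₀ p₁ p₂ q₀ q₁ q₂ r₀ r₁ r₂ s₀ s₁ s₂ →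
    :parallel ⟨ z₀ , z₁ , z₂ ⟩ ⟨ p₀ , p₁ , p₂ ⟩ ⟨ q₀ , q₁ , q₂ ⟩ ⟨ r₀ , r₁ , r₂ ⟩ ⟨ s₀ , s₁ , s₂ ⟩ 2F) refl
    (z 0F) (z 1F) (z 2F) (p 0F) (p 1F) (p 2F) (q 0F) (q 1F) (q 2F)
    (r 0F) (r 1F) (r 2F) (s 0F) (s 1F) (s 2F)

  module _ {p q r s : S²} (A : Arc p q) (B : Arc r s) {ε₁ ε₂ : Sign}
    (sε₁ : HasSign ε₁ (coords p ∙ Arc.middle A)) (sε₂ : HasSign ε₂ (coords r ∙ Arc.middle B))
    (pq<1 : 0# < 1# - coords p ∙ coords q) (rs<1 : 0# < 1# - coords r ∙ coords s)
    where

    -- The coordinates of the antipode are those of z negated, so the four signs decide for both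
    -- points whether they lie on either arc.
    once : ∀ sα sβ sγ sδ {α β γ δ μ} (z : S²) →
      HasSign sα α → HasSign sβ β → HasSign sγ γ → HasSign sδ δ → 0# < μ →
      (∀ i → μ * coords z i ≈ α * coords p i + β * coords q i) →
      (∀ i → μ * coords z i ≈ γ * coords r i + δ * coords s i) →
      z ∈ₐ A → z ∈ₐ B → ¬ (antipode z ∈ₐ A × antipode z ∈ₐ B) →
      T (meetsOnce ε₁ ε₂ sα sβ sγ sδ)
    once sα sβ sγ sδ {α} {β} {γ} {δ} {μ} z pα pβ pγ pδ 0<μ μz≈₁ μz≈₂ z∈A z∈B -z∉ =
      -- The goal is the truth of a Boolean, so the signs may be obtained under a double negation.
      decidable-stable (T? _) λ ¬once →
      inside-sign A ε₁ sα sβ z sε₁ pq<1 pα pβ 0<μ μz≈₁ λ zA →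
      inside-sign B ε₂ sγ sδ z sε₂ rs<1 pγ pδ 0<μ μz≈₂ λ zB →
      inside-sign A ε₁ (opposite sα) (opposite sβ) (antipode z) sε₁ pq<1
        (sign-neg sα pα) (sign-neg sβ pβ) 0<μ (flip μz≈₁) λ -zA →
      inside-sign B ε₂ (opposite sγ) (opposite sδ) (antipode z) sε₂ rs<1
        (sign-neg sγ pγ) (sign-neg sδ pδ) 0<μ (flip μz≈₂) λ -zB →
      ¬once $ Equivalence.from T-∧
        ( Equivalence.from T-∧ (∈ₐ⇒positive A (inside ε₁ sα sβ) z zA z∈A
                               , ∈ₐ⇒positive B (inside ε₂ sγ sδ) z zB z∈B)
        , T-not λ meets → let (inA , inB) = Equivalence.to T-∧ meets in -z∉
          ( positive⇒∈ₐ A (inside ε₁ (opposite sα) (opposite sβ)) (antipode z) -zA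
              (antipode-on z (Arc.circle A) (proj₁ z∈A)) inA
          , positive⇒∈ₐ B (inside ε₂ (opposite sγ) (opposite sδ)) (antipode z) -zB
              (antipode-on z (Arc.circle B) (proj₁ z∈B)) inB))
      where
      flip : ∀ {ζ ξ} {x y : ℝ³} → (∀ i → μ * coords z i ≈ ζ * x i + ξ * y i) →
        ∀ i → μ * - coords z i ≈ - ζ * x i + - ξ * y i
      flip {ζ} {ξ} {x} {y} eq i = begin
        μ * - coords z i         ≈⟨ solve 2 (λ a b → a :* :- b := :- (a :* b)) refl _ _ ⟩
        - (μ * coords z i)       ≈⟨ -‿cong (eq i) ⟩
        - (ζ * x i + ξ * y i)
          ≈⟨ solve 4 (λ a b c d → :- (a :* c :+ b :* d) := :- a :* c :+ :- b :* d) refl ζ ξ (x i) (y i) ⟩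
        - ζ * x i + - ξ * y i    ∎

    -- The common point satisfies w = μ z for the vector w on both circles. If μ is positive, the
    -- first alternative of `Crosses` holds; if μ is negative, negating the coordinates gives the
    -- second. The antipode is not on both arcs, by uniqueness of z.
    crosses : ∀ a b c d →
      HasSign a (det (coords p) (coords r) (coords s)) →
      HasSign b (det (coords q) (coords r) (coords s)) →
      HasSign c (det (coords p) (coords q) (coords r)) →
      HasSign d (det (coords p) (coords q) (coords s)) →
      ∃! _≈ₛ_ (λ x → x ∈ₐ A × x ∈ₐ B) → Crosses ε₁ ε₂ a b c d
    crosses a b c d sa sb sc sd (z , (z∈A , z∈B) , unique) = decidable-stable (T? _) λ ¬crosses →
      ¬¬sign μ≉0 λ where
        (Sign.+ , 0<μ) → ¬crosses $ Equivalence.from T-∨ $ inj₁ $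
          once (opposite b) a d (opposite c) z
            (sign-neg b sb) sa sd (sign-neg c sc) 0<μ μz≈₁ μz≈₂ z∈A z∈B -z∉
        (Sign.- , μ<0) → ¬crosses $ Equivalence.from T-∨ $ inj₂ $
          once b (opposite a) (opposite d) c z
            sb (sign-neg a sa) (sign-neg d sd) sc (sign-neg Sign.- μ<0)
            (λ i → trans (solve 2 (λ a b → :- a :* b := :- (a :* b)) refl μ (z′ i))
              (trans (-‿cong (μz≈₁ i))
              (solve 4 (λ a b c d → :- (:- a :* c :+ b :* d) := a :* c :+ :- b :* d) refl B′ A′ (u i) (v i))))
            (λ i → trans (solve 2 (λ a b → :- a :* b := :- (a :* b)) refl μ (z′ i))
              (trans (-‿cong (μz≈₂ i))
              (solve 4 (λ a b c d → :- (a :* c :+ :- b :* d) := :- a :* c :+ b :* d) refl D′ C′ (x i) (y i))))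
            z∈A z∈B -z∉
      where
      u = coords p
      v = coords q
      x = coords r
      y = coords s
      z′ = coords z
      A′ = det u x y
      B′ = det v x y
      C′ = det u v x
      D′ = det u v y

      w : ℝ³
      w i = - B′ * u i + A′ * v i

      μ : Carrier
      μ = z′ ∙ w

      -z∉ : ¬ (antipode z ∈ₐ A × antipode z ∈ₐ B)
      -z∉ -z∈ = x≉antipode z (unique {antipode z} -z∈)

      on-circle : ∀ {p q} (A : Arc p q) → z ∈ₐ A → det z′ (coords p) (coords q) ≈ 0#
      on-circle {p} {q} A (z-on , _) = orthogonal⇒coplanar normal z′ (coords p) (coords q) nonzero z-on p-on q-on
        where
        open Arc A using (circle; p-on; q-on)
        open GreatCircle circle

      μz≈₁ : ∀ i → μ * z′ i ≈ - B′ * u i + A′ * v i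
      μz≈₁ i = sym $ begin
        w i              ≈⟨ *-identityˡ _ ⟨
        1# * w i         ≈⟨ *-congʳ (proj₂ z) ⟨
        (z′ ∙ z′) * w i  ≈⟨ parallel z′ u v x y i ⟩
        μ * z′ i + (det z′ u v * (z′ ⊗ (x ⊗ y)) i - det z′ x y * (z′ ⊗ (u ⊗ v)) i)
          ≈⟨ +-congˡ (+-cong (*-congʳ (on-circle A z∈A)) (-‿cong (*-congʳ (on-circle B z∈B)))) ⟩
        μ * z′ i + (0# * (z′ ⊗ (x ⊗ y)) i - 0# * (z′ ⊗ (u ⊗ v)) i)
          ≈⟨ solve 3 (λ a b c → a :+ (con ℤ.0ℤ :* b :- con ℤ.0ℤ :* c) := a) refl _ _ _ ⟩
        μ * z′ i ∎

      μz≈₂ : ∀ i → μ * z′ i ≈ D′ * x i + - C′ * y i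
      μz≈₂ i = trans (μz≈₁ i) (trans (cramer u v x y i)
        (solve 4 (λ a b c d → a :* c :- b :* d := a :* c :+ :- b :* d) refl D′ C′ (x i) (y i)))

      -- If μ were 0, then w = 0; but w ∙ (v ⊗ x) = - B′ C′, because v ∙ (v ⊗ x) = 0.
      μ≉0 : ¬ (μ ≈ 0#)
      μ≉0 μ≈0 = sign⇒≉0 (b Sign.* c) (sign-* b c sb sc) $ begin
        B′ * C′  ≈⟨ solve 2 (λ b c → b :* c := :- (:- b :* c)) refl B′ C′ ⟩
        - (- B′ * C′)
          ≈⟨ -‿cong (solve 11 (λ b a d e f g h i j k l →
               let u = ⟨ d , e , f ⟩ ; v = ⟨ g , h , i ⟩ ; x = ⟨ j , k , l ⟩ in
               b :* :det u v x := b :* (u :∙ (v :⊗ x)) :+ a :* (v :∙ (v :⊗ x))) refl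
               (- B′) A′ (u 0F) (u 1F) (u 2F) (v 0F) (v 1F) (v 2F) (x 0F) (x 1F) (x 2F)) ⟩
        - (- B′ * (u ∙ v ⊗ x) + A′ * (v ∙ v ⊗ x))  ≈⟨ -‿cong (combination-∙ (- B′) A′ u v (v ⊗ x)) ⟨
        - (w ∙ v ⊗ x)                  ≈⟨ -‿cong (∙-congˡ (v ⊗ x) (sym ∘ μz≈₁)) ⟩
        - ((λ i → μ * z′ i) ∙ v ⊗ x)   ≈⟨ -‿cong (scale-∙ μ z′ (v ⊗ x)) ⟩
        - (μ * (z′ ∙ v ⊗ x))           ≈⟨ -‿cong (*-congʳ μ≈0) ⟩
        - (0# * (z′ ∙ v ⊗ x))          ≈⟨ solve 1 (λ a → :- (con ℤ.0ℤ :* a) := con ℤ.0ℤ) refl _ ⟩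
        0# ∎

-- Crossing patterns that no choice of signs realises

∀? : ∀ {P : Sign → Set} → (∀ s → Dec (P s)) → Dec (∀ s → P s)
∀? P? = map′ (λ { (p , q) Sign.+ → p ; (p , q) Sign.- → q }) (λ f → f Sign.+ , f Sign.-)
             (P? Sign.+ ×-dec P? Sign.-)

⊥? : Dec ⊥
⊥? = no λ ()

-- The signs of three nonzero numbers with sum zero.
ZeroSum : (x y z : Sign) → Set
ZeroSum x y z = ¬ (x ≡ y × y ≡ z)

ZeroSum? : ∀ x y z → Dec (ZeroSum x y z)
ZeroSum? x y z = ¬? (x ≟ˢ y ×-dec y ≟ˢ z)

-- In the following lemmas a variable named by three letters, such as abo, is the sign of the
-- determinant of these three points. The finitely many cases are decided by evaluation; stating each
-- hypothesis as soon as its variables are bound lets the evaluation prune the cases early.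

-- Short arcs a b and o d can cross only if d lies on the same side of the circle o a as b, and
-- likewise for e; so d and e cannot be on different sides.
all-short-one-side :
  ∀ abo aod bod abd → Crosses Sign.+ Sign.+ aod bod abo abd →
  ∀ aoe boe abe → aod ≢ aoe → Crosses Sign.+ Sign.+ aoe boe abo abe → ⊥
all-short-one-side = toWitness
  {a? = ∀? λ _ → ∀? λ _ → ∀? λ _ → ∀? λ _ → T? _ →-dec
        ∀? λ _ → ∀? λ _ → ∀? λ _ → ¬? (_ ≟ˢ _) →-dec T? _ →-dec ⊥?} _

-- That b c crosses both o a and o d makes `bod` equal to `abo`. If d were on the same side of the
-- circle o a as b, the only point where o d could meet the circle a b would then be on the short
-- arc from a to b, whereas the edge is the long one.
all-short-long-middle :
  ∀ abo aod bod abd → abo ≢ aod → Crosses Sign.- Sign.+ aod bod abo abd →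
  ∀ coa bco bca → Crosses Sign.+ Sign.+ abo coa bco bca →
  ∀ cod bcd → Crosses Sign.+ Sign.+ bod cod bco bcd → ⊥
all-short-long-middle = toWitness
  {a? = ∀? λ _ → ∀? λ _ → ∀? λ _ → ∀? λ _ → ¬? (_ ≟ˢ _) →-dec T? _ →-dec
        ∀? λ _ → ∀? λ _ → ∀? λ _ → T? _ →-dec
        ∀? λ _ → ∀? λ _ → T? _ →-dec ⊥?} _

-- Here o p is long and a b short. The crossings of a b with o d and with p q fix the signs so that
-- a b can meet the circle o p only on the short arc from o to p.
long-short :
  ∀ poa qoa pqo apq → Crosses Sign.+ Sign.+ poa qoa pqo apq →
  ∀ aop → poa ≢ aop →
  ∀ pod qod pqd → Crosses Sign.+ Sign.+ pod qod pqo pqd →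
  ∀ aod → pod ≢ aod →
  ∀ bod abo abd → Crosses Sign.+ Sign.+ aod bod abo abd →
  ∀ bpq abp abq → Crosses Sign.+ Sign.+ apq bpq abp abq →
  ∀ bop → Crosses Sign.+ Sign.- aop bop abo abp → ⊥
long-short = toWitness
  {a? = ∀? λ _ → ∀? λ _ → ∀? λ _ → ∀? λ _ → T? _ →-dec
        ∀? λ _ → ¬? (_ ≟ˢ _) →-dec
        ∀? λ _ → ∀? λ _ → ∀? λ _ → T? _ →-dec
        ∀? λ _ → ¬? (_ ≟ˢ _) →-dec
        ∀? λ _ → ∀? λ _ → ∀? λ _ → T? _ →-dec
        ∀? λ _ → ∀? λ _ → ∀? λ _ → T? _ →-dec
        ∀? λ _ → T? _ →-dec ⊥?} _

-- Here o p and a b are both long. The crossings force `bop` and `bcp` to be opposite, while the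
-- Grassmann-Plücker relations at b and at p, in this order the last two hypotheses, force them to
-- be equal.
long-long :
  ∀ poa qoa pqo apq → Crosses Sign.+ Sign.+ poa qoa pqo apq →
  ∀ aop → poa ≢ aop →
  ∀ pod qod pqd → Crosses Sign.+ Sign.+ pod qod pqo pqd →
  ∀ aod → pod ≢ aod →
  ∀ abo coa bco bca → Crosses Sign.+ Sign.+ abo coa bco bca →
  ∀ bod cod bcd → Crosses Sign.+ Sign.+ bod cod bco bcd →
  ∀ abd → Crosses Sign.- Sign.+ aod bod abo abd →
  ∀ bpq abp abq → Crosses Sign.- Sign.+ apq bpq abp abq →
  ∀ bop → Crosses Sign.- Sign.- aop bop abo abp →
  ∀ cop bcp → Crosses Sign.+ Sign.- bop cop bco bcp →
  ∀ cpq bcq → Crosses Sign.+ Sign.+ bpq cpq bcp bcq →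
  ZeroSum (bco Sign.* abp) (opposite (bcp Sign.* abo)) (bca Sign.* bop) →
  ZeroSum (apq Sign.* bop) (opposite (bpq Sign.* aop)) (pqo Sign.* abp) → ⊥
long-long = toWitness
  {a? = ∀? λ _ → ∀? λ _ → ∀? λ _ → ∀? λ _ → T? _ →-dec
        ∀? λ _ → ¬? (_ ≟ˢ _) →-dec
        ∀? λ _ → ∀? λ _ → ∀? λ _ → T? _ →-dec
        ∀? λ _ → ¬? (_ ≟ˢ _) →-dec
        ∀? λ _ → ∀? λ _ → ∀? λ _ → ∀? λ _ → T? _ →-dec
        ∀? λ _ → ∀? λ _ → ∀? λ _ → T? _ →-dec
        ∀? λ _ → T? _ →-dec
        ∀? λ _ → ∀? λ _ → ∀? λ _ → T? _ →-dec
        ∀? λ _ → T? _ →-dec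
        ∀? λ _ → ∀? λ _ → T? _ →-dec
        ∀? λ _ → ∀? λ _ → T? _ →-dec
        ZeroSum? _ _ _ →-dec ZeroSum? _ _ _ →-dec ⊥?} _

-- The short arc p q crosses both o a and o d, so a and d lie on the same side of the circle o p and
-- `poa` equals `pod`. Exchanging a and d therefore reverses which of them is crossed first.
opposite-sides :
  ∀ poa qoa pqo pqa → Crosses Sign.+ Sign.+ poa qoa pqo pqa →
  ∀ pod qod pqd → Crosses Sign.+ Sign.+ pod qod pqo pqd →
  ∀ aod doa → aod ≢ doa → aod ≡ pod → doa ≢ poa
opposite-sides = toWitness
  {a? = ∀? λ _ → ∀? λ _ → ∀? λ _ → ∀? λ _ → T? _ →-dec
        ∀? λ _ → ∀? λ _ → ∀? λ _ → T? _ →-dec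
        ∀? λ _ → ∀? λ _ → ¬? (_ ≟ˢ _) →-dec (_ ≟ˢ _) →-dec ¬? (_ ≟ˢ _)} _

-- The sign `12ˢ` records on which side of the circle through o and the first arm the second arm
-- starts. If neither of the first two circles separates the other arms, the third does: `31ˢ`
-- equals `21ˢ`, hence `23ˢ`, which is opposite to `32ˢ`.
some-middle :
  ∀ 12ˢ 21ˢ 13ˢ 31ˢ 23ˢ 32ˢ → 12ˢ ≢ 21ˢ → 13ˢ ≢ 31ˢ → 23ˢ ≢ 32ˢ →
  12ˢ ≡ 13ˢ → 21ˢ ≡ 23ˢ → 31ˢ ≢ 32ˢ
some-middle = toWitness
  {a? = ∀? λ _ → ∀? λ _ → ∀? λ _ → ∀? λ _ → ∀? λ _ → ∀? λ _ →
        ¬? (_ ≟ˢ _) →-dec ¬? (_ ≟ˢ _) →-dec ¬? (_ ≟ˢ _) →-dec (_ ≟ˢ _) →-dec (_ ≟ˢ _) →-dec ¬? (_ ≟ˢ _)} _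

-- χ u v w is the sign of the determinant of the positions of u, v, w (junk unless they are distinct),
-- and ε e is + or - according to whether the arc of e is shorter or longer than π.
record SignedThrackle (G : Graph) : Set where
  open Graph G
  field
    χ         : Vertex → Vertex → Vertex → Sign
    χ-cyclic  : ∀ u v w → χ u v w ≡ χ v w u
    χ-swap    : ∀ {u v w} → u ≢ v → v ≢ w → u ≢ w → χ u v w ≢ χ u w v
    χ-zeroSum : ∀ {a b c d e} → a ≢ b → a ≢ c → a ≢ d → a ≢ e →
                b ≢ c → b ≢ d → b ≢ e → c ≢ d → c ≢ e → d ≢ e →
                ZeroSum (χ a b c Sign.* χ a d e) (opposite (χ a b d Sign.* χ a c e)) (χ a b e Sign.* χ a c d)
    ε         : ∀ {u v} → u ~ v → Sign
    ε-star    : ∀ {u v w} (e : u ~ v) (f : u ~ w) → v ≢ w → ε e ≡ Sign.- → ε f ≡ Sign.+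
    ε-path    : ∀ {u v w} (e : u ~ v) (f : v ~ w) → u ≢ w → ε e ≡ Sign.- → ε f ≡ Sign.+
    crossing  : ∀ {p q r s} (e : p ~ q) (f : r ~ s) → p ≢ r → p ≢ s → q ≢ r → q ≢ s →
                Crosses (ε e) (ε f) (χ p r s) (χ q r s) (χ p q r) (χ p q s)

-- Extracting the signs from a drawing.

∃!-map : ∀ {a p q r} {A : Set a} {_≈_ : A → A → Set r} {P : A → Set p} {Q : A → Set q} →
  (∀ x → P x → Q x) → (∀ x → Q x → P x) → ∃! _≈_ P → ∃! _≈_ Q
∃!-map P⇒Q Q⇒P (x , Px , unique) = x , P⇒Q x Px , λ {y} Qy → unique (Q⇒P y Qy)

¬¬-∀Fin : ∀ {p n} {P : Fin n → Set p} → (∀ i → ¬ ¬ P i) → ¬ ¬ (∀ i → P i)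
¬¬-∀Fin = Finₚ.sequence (RawMonad.rawApplicative ¬¬-Monad)

-- `T b` has at most one proof, so this is a quantifier over a set with at most one element.
¬¬-∀T : ∀ {p} b {P : T b → Set p} → (∀ t → ¬ ¬ P t) → ¬ ¬ (∀ t → P t)
¬¬-∀T true  ¬¬P ¬∀P = ¬¬P _ λ p → ¬∀P λ _ → p
¬¬-∀T false ¬¬P ¬∀P = ¬∀P λ ()

module Signs {c ℓ} (R : RealNumbers c ℓ) (G : Graph) where
  open RealNumbers R
  open OrderedField R
  open Vectors R
  open Circles R
  open Crossing R
  open Sphere R
  open Graph G

  reverse : ∀ {p q} → Arc p q → Arc q p
  reverse A = record
    { circle = circle ; p-on = q-on ; q-on = p-on ; middle = middle
    ; nonzero = nonzero ; in-plane = in-plane ; same-level = sym same-level }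
    where open Arc A

  ∈-reverse⁺ : ∀ {p q} (A : Arc p q) x → x ∈ₐ A → x ∈ₐ reverse A
  ∈-reverse⁺ A x (x-on , p≤x) = x-on , p≤x ∘ <-respʳ (sym (Arc.same-level A))

  ∈-reverse⁻ : ∀ {p q} (A : Arc p q) x → x ∈ₐ reverse A → x ∈ₐ A
  ∈-reverse⁻ A x (x-on , q≤x) = x-on , q≤x ∘ <-respʳ (Arc.same-level A)

  start∈ : ∀ {p q} (A : Arc p q) → p ∈ₐ A
  start∈ A = Arc.p-on A , <-irrefl refl

  antipode∈long : ∀ {p q} (A : Arc p q) → HasSign Sign.- (coords p ∙ Arc.middle A) → antipode p ∈ₐ A
  antipode∈long {p} A p<0 = antipode-on p circle p-on , <-asym
    (<-trans p<0 (<-respʳ (sym (neg-∙ (coords p) middle)) (sign-neg Sign.- p<0)))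
    where open Arc A

  -- Both arcs contain p and also its antipode, whose level is positive while that of p is negative.
  ¬both-long : ∀ {p q r} (A : Arc p q) (B : Arc p r) →
    HasSign Sign.- (coords p ∙ Arc.middle A) → HasSign Sign.- (coords p ∙ Arc.middle B) →
    ¬ ∃! _≈ₛ_ (λ x → x ∈ₐ A × x ∈ₐ B)
  ¬both-long {p} A B A-long B-long (z , _ , unique) = x≉antipode p λ i → trans
    (sym (unique {p} (start∈ A , start∈ B) i))
    (unique {antipode p} (antipode∈long A A-long , antipode∈long B B-long) i)

  Trichotomy : Carrier → Set ℓ
  Trichotomy x = x ≈ 0# ⊎ (∃[ s ] HasSign s x)

  trichotomy : ∀ x → ¬ ¬ Trichotomy x
  trichotomy x ¬tri = ¬¬sign (¬tri ∘ inj₁) (¬tri ∘ inj₂)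

  -- The value for zero is junk.
  sign : ∀ {x} → Trichotomy x → Sign
  sign (inj₁ _)       = Sign.+
  sign (inj₂ (s , _)) = s

  sign-correct : ∀ {x} (t : Trichotomy x) → ¬ x ≈ 0# → HasSign (sign t) x
  sign-correct (inj₁ x≈0)      x≉0 = contradiction x≈0 x≉0
  sign-correct (inj₂ (s , sx)) _   = sx

  -- The trichotomies are chosen separately for each triple of vertices. Agreement also at zero
  -- makes `χ-cyclic` hold without any distinctness hypothesis.
  sign-cong : ∀ {x y} (t : Trichotomy x) (t′ : Trichotomy y) → x ≈ y → sign t ≡ sign t′
  sign-cong (inj₁ _)        (inj₁ _)        _   = ≡.refl
  sign-cong (inj₁ x≈0)      (inj₂ (s , sy)) x≈y = contradiction (trans (sym x≈y) x≈0) (sign⇒≉0 s sy)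
  sign-cong (inj₂ (s , sx)) (inj₁ y≈0)      x≈y = contradiction (trans x≈y y≈0) (sign⇒≉0 s sx)
  sign-cong (inj₂ (s , sx)) (inj₂ (t , ty)) x≈y = sign-unique s t (sign-resp s x≈y sx) ty

  zeroSum : ∀ s t r {x y z} → HasSign s x → HasSign t y → HasSign r z → x + y + z ≈ 0# → ZeroSum s t r
  zeroSum s .s .s sx sy sz sum≈0 (≡.refl , ≡.refl) = sign⇒≉0 s (sign-+ s (sign-+ s sx sy) sz) sum≈0

  module _ (D : GreatCircleThrackle G) (gp : GeneralPosition D) where
    open GreatCircleThrackle D
    open GeneralPosition gp

    position : Vertex → ℝ³
    position = coords ∘ point

    -- The drawing has an arc only from the smaller end of an edge to the larger one.
    data Oriented (u v : Vertex) : Set where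
      forward  : u Fin.< v → u ~ v → Oriented u v
      backward : v Fin.< u → v ~ u → Oriented u v

    orient : ∀ {u v} → u ~ v → Oriented u v
    orient {u} {v} e with Finₚ.<-cmp u v
    ... | tri< u<v _ _ = forward u<v e
    ... | tri≈ _ u≡v _ = contradiction e (~-irrefl u≡v)
    ... | tri> _ _ v<u = backward v<u (~-sym e)

    edge : ∀ {u v} → Oriented u v → Edge
    edge {u} {v} (forward u<v e)  = (u , v) , u<v , e
    edge {u} {v} (backward v<u e) = (v , u) , v<u , e

    orientedArc : ∀ {u v} → Oriented u v → Arc (point u) (point v)
    orientedArc o@(forward  _ _) = arc (edge o)
    orientedArc o@(backward _ _) = reverse (arc (edge o))

    ∈-edge⁺ : ∀ {u v} (o : Oriented u v) x → x ∈ₐ orientedArc o → x ∈ₐ arc (edge o)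
    ∈-edge⁺ (forward  _ _) x x∈ = x∈
    ∈-edge⁺ o@(backward _ _) x x∈ = ∈-reverse⁻ (arc (edge o)) x x∈

    ∈-edge⁻ : ∀ {u v} (o : Oriented u v) x → x ∈ₐ arc (edge o) → x ∈ₐ orientedArc o
    ∈-edge⁻ (forward  _ _) x x∈ = x∈
    ∈-edge⁻ o@(backward _ _) x x∈ = ∈-reverse⁺ (arc (edge o)) x x∈

    edgeArc : ∀ {u v} → u ~ v → Arc (point u) (point v)
    edgeArc = orientedArc ∘ orient

    MeetOnce : ∀ {p q r s} → Arc p q → Arc r s → Set _
    MeetOnce A B = ∃! _≈ₛ_ (λ x → x ∈ₐ A × x ∈ₐ B)

    arcs-meet-once : ∀ {u v x y} (o : Oriented u v) (o′ : Oriented x y) →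
      endpoints (edge o) ≢ endpoints (edge o′) → MeetOnce (orientedArc o) (orientedArc o′)
    arcs-meet-once o o′ e≢f = ∃!-map
      (λ z (z∈e , z∈f) → ∈-edge⁻ o z z∈e , ∈-edge⁻ o′ z z∈f)
      (λ z (z∈e , z∈f) → ∈-edge⁺ o z z∈e , ∈-edge⁺ o′ z z∈f)
      (meet-once (edge o) (edge o′) e≢f)

    ≢-edges₁ : ∀ {u v x y} (o : Oriented u v) (o′ : Oriented x y) → u ≢ x → u ≢ y →
      endpoints (edge o) ≢ endpoints (edge o′)
    ≢-edges₁ (forward  _ _) (forward  _ _) u≢x u≢y ≡.refl = u≢x ≡.refl
    ≢-edges₁ (forward  _ _) (backward _ _) u≢x u≢y ≡.refl = u≢y ≡.refl
    ≢-edges₁ (backward _ _) (forward  _ _) u≢x u≢y ≡.refl = u≢y ≡.refl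
    ≢-edges₁ (backward _ _) (backward _ _) u≢x u≢y ≡.refl = u≢x ≡.refl

    ≢-edges₂ : ∀ {u v x y} (o : Oriented u v) (o′ : Oriented x y) → v ≢ x → v ≢ y →
      endpoints (edge o) ≢ endpoints (edge o′)
    ≢-edges₂ (forward  _ _) (forward  _ _) v≢x v≢y ≡.refl = v≢y ≡.refl
    ≢-edges₂ (forward  _ _) (backward _ _) v≢x v≢y ≡.refl = v≢x ≡.refl
    ≢-edges₂ (backward _ _) (forward  _ _) v≢x v≢y ≡.refl = v≢x ≡.refl
    ≢-edges₂ (backward _ _) (backward _ _) v≢x v≢y ≡.refl = v≢y ≡.refl

    ~⇒≢ : ∀ {u v} → u ~ v → u ≢ v
    ~⇒≢ e u≡v = ~-irrefl u≡v e

    level : ∀ {u v} → u ~ v → Carrier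
    level {u} e = position u ∙ Arc.middle (edgeArc e)

    ε-level≉0 : ∀ {u v} (e : u ~ v) → ¬ level e ≈ 0#
    ε-level≉0 {u} {v} e = level≉0 (edgeArc e) (point-distinct (~⇒≢ e)) (no-antipodal u v)

    -- If the determinant vanished, all three points would lie on the circle with normal v ⊗ w, a
    -- nonzero vector since v and w are neither equal nor antipodal.
    det≉0 : ∀ {u v w} → u ≢ v → v ≢ w → u ≢ w → ¬ det (position u) (position v) (position w) ≈ 0#
    det≉0 {u} {v} {w} u≢v v≢w u≢w det≈0 =
      independent (proj₂ (point v)) (proj₂ (point w)) (point-distinct v≢w) (no-antipodal v w) λ 0<vw →
      no-three-on-circle u≢v v≢w u≢w
        ( record { normal = position v ⊗ position w ; nonzero = 0<norm²⇒nonzero _ 0<vw }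
        , det≈0 , det-first≈0 (position v) (position w) , det-second≈0 (position v) (position w))

    short-chord : ∀ {u v} → u ≢ v → ¬ ¬ (0# < 1# - position u ∙ position v)
    short-chord {u} {v} u≢v = distinct⇒uv<1 (proj₂ (point u)) (proj₂ (point v)) (point-distinct u≢v)

    signedThrackle : ¬ ¬ SignedThrackle G
    signedThrackle ¬signed =
      -- There are finitely many determinants and levels, so all the choices can be made under one
      -- double negation.
      ¬¬-∀Fin (λ u → ¬¬-∀Fin λ v → ¬¬-∀Fin λ w →
        trichotomy (det (position u) (position v) (position w))) λ orientation →
      ¬¬-∀Fin (λ u → ¬¬-∀Fin λ v → ¬¬-∀T (adj u v) λ e → trichotomy (level {u} {v} e)) λ levels →
      ¬signed (build orientation λ {u} {v} → levels u v)
      where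
      build : (∀ u v w → Trichotomy (det (position u) (position v) (position w))) →
              (∀ {u v} (e : u ~ v) → Trichotomy (level e)) → SignedThrackle G
      build orientation levels = record
        { χ = χ
        ; χ-cyclic = λ u v w → sign-cong (orientation u v w) (orientation v w u)
                       (det-cyclic (position u) (position v) (position w))
        ; χ-swap = λ {u} {v} {w} u≢v v≢w u≢w eq →
            s≢opposite[s] (χ u v w) (≡.trans eq (sign-unique (χ u w v) (opposite (χ u v w))
              (χ-sign u≢w (v≢w ∘ ≡.sym) u≢v)
              (sign-resp (opposite (χ u v w)) (sym (det-swap (position u) (position v) (position w)))
                (sign-neg (χ u v w) (χ-sign u≢v v≢w u≢w)))))
        ; χ-zeroSum = λ {a} {b} {c} {d} {e} a≢b a≢c a≢d a≢e b≢c b≢d b≢e c≢d c≢e d≢e →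
            zeroSum _ _ _
              (sign-* (χ a b c) (χ a d e) (χ-sign a≢b b≢c a≢c) (χ-sign a≢d d≢e a≢e))
              (sign-neg (χ a b d Sign.* χ a c e)
                (sign-* (χ a b d) (χ a c e) (χ-sign a≢b b≢d a≢d) (χ-sign a≢c c≢e a≢e)))
              (sign-* (χ a b e) (χ a c d) (χ-sign a≢b b≢e a≢e) (χ-sign a≢c c≢d a≢d))
              (grassmann-plücker (position a) (position b) (position c) (position d) (position e))
        ; ε = ε
        ; ε-star = λ e f v≢w e-long → ¬-⇒+ λ f-long →
            ¬both-long (edgeArc e) (edgeArc f) (long e e-long) (long f f-long)
              (arcs-meet-once (orient e) (orient f) (≢-edges₂ (orient e) (orient f) (~⇒≢ e ∘ ≡.sym) v≢w))
        -- The common vertex is the end of the first arc, which is therefore reversed; its level is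
        -- the same at both ends.
        ; ε-path = λ e f u≢w e-long → ¬-⇒+ λ f-long →
            ¬both-long (reverse (edgeArc e)) (edgeArc f)
              (<-respˡ (Arc.same-level (edgeArc e)) (long e e-long)) (long f f-long)
              (∃!-map (λ x (x∈e , x∈f) → ∈-reverse⁺ (edgeArc e) x x∈e , x∈f)
                      (λ x (x∈e , x∈f) → ∈-reverse⁻ (edgeArc e) x x∈e , x∈f)
                (arcs-meet-once (orient e) (orient f) (≢-edges₁ (orient e) (orient f) (~⇒≢ e) u≢w)))
        ; crossing = λ {p} {q} {r} {s} e f p≢r p≢s q≢r q≢s → decidable-stable (T? _) λ ¬crosses →
            short-chord (~⇒≢ e) λ pq<1 → short-chord (~⇒≢ f) λ rs<1 →
            ¬crosses (crosses (edgeArc e) (edgeArc f) (ε-sign e) (ε-sign f) pq<1 rs<1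
              (χ p r s) (χ q r s) (χ p q r) (χ p q s)
              (χ-sign p≢r (~⇒≢ f) p≢s) (χ-sign q≢r (~⇒≢ f) q≢s)
              (χ-sign (~⇒≢ e) q≢r p≢r) (χ-sign (~⇒≢ e) q≢s p≢s)
              (arcs-meet-once (orient e) (orient f) (≢-edges₁ (orient e) (orient f) p≢r p≢s)))
        }
        where
        χ : Vertex → Vertex → Vertex → Sign
        χ u v w = sign (orientation u v w)

        ε : ∀ {u v} → u ~ v → Sign
        ε e = sign (levels e)

        χ-sign : ∀ {u v w} → u ≢ v → v ≢ w → u ≢ w →
          HasSign (χ u v w) (det (position u) (position v) (position w))
        χ-sign {u} {v} {w} u≢v v≢w u≢w = sign-correct (orientation u v w) (det≉0 u≢v v≢w u≢w)

        ε-sign : ∀ {u v} (e : u ~ v) → HasSign (ε e) (level e)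
        ε-sign e = sign-correct (levels e) (ε-level≉0 e)

        long : ∀ {u v} (e : u ~ v) → ε e ≡ Sign.- → HasSign Sign.- (level e)
        long e e-long = ≡.subst (λ s → HasSign s (level e)) e-long (ε-sign e)

        ¬-⇒+ : ∀ {s} → s ≢ Sign.- → s ≡ Sign.+
        ¬-⇒+ {Sign.+} _   = ≡.refl
        ¬-⇒+ {Sign.-} s≢- = contradiction ≡.refl s≢-

-- Spiders

Unique-resp-↭ : ∀ {A : Set} {xs ys : List A} → xs ↭ ys → Unique xs → Unique ys
Unique-resp-↭ {A} = Permutationₛ.Unique-resp-↭ (≡.setoid A) ∘ ↭⇒↭ₛ

lookup-injective : ∀ {A : Set} {xs : List A} → Unique xs → ∀ {i j} → lookup xs i ≡ lookup xs j → i ≡ j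
lookup-injective (_  ∷ _)   {zero}  {zero}  _  = ≡.refl
lookup-injective (x≢ ∷ _)   {zero}  {suc j} eq = contradiction eq (All.lookup x≢ (∈-lookup j))
lookup-injective (x≢ ∷ _)   {suc i} {zero}  eq = contradiction (≡.sym eq) (All.lookup x≢ (∈-lookup i))
lookup-injective (_  ∷ !xs) {suc i} {suc j} eq = ≡.cong suc (lookup-injective !xs eq)

-- For concrete positions the implicit argument is filled by evaluation, so one uniqueness proof
-- yields every inequality between the vertices of a spider.
lookup-≢ : ∀ {A : Set} {xs : List A} → Unique xs → ∀ i j {i≢j : False (i Finₚ.≟ j)} →
  lookup xs i ≢ lookup xs j
lookup-≢ !xs i j {i≢j} = toWitnessFalse i≢j ∘ lookup-injective !xs

module Spiders (G : Graph) where
  open Graph G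

  record Arm (o : Vertex) : Set where
    constructor arm
    field
      {a b c} : Vertex
      oa : o ~ a
      ab : a ~ b
      bc : b ~ c
    joints : List Vertex
    joints = a ∷ b ∷ c ∷ []
  open Arm public using (joints)

  record Spider : Set where
    field
      {o}    : Vertex
      A B C  : Arm o
      unique : Unique (o ∷ joints A ++ joints B ++ joints C)

  module _ (S : SignedThrackle G) where
    open SignedThrackle S

    crossing-with : ∀ {p q r s} (e : p ~ q) (f : r ~ s) {ε₁ ε₂} → ε e ≡ ε₁ → ε f ≡ ε₂ →
      p ≢ r → p ≢ s → q ≢ r → q ≢ s →
      Crosses ε₁ ε₂ (χ p r s) (χ q r s) (χ p q r) (χ p q s)
    crossing-with e f ≡.refl ≡.refl = crossing e f

    χ-reverse : ∀ {u v w} → u ≢ v → v ≢ w → u ≢ w → χ u v w ≢ χ w v u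
    χ-reverse {u} {v} {w} u≢v v≢w u≢w eq = χ-swap u≢v v≢w u≢w (≡.trans eq (≡.sym (χ-cyclic u w v)))

    sign-cases : ∀ s → (s ≡ Sign.+ → ⊥) → (s ≡ Sign.- → ⊥) → ⊥
    sign-cases Sign.+ p m = p ≡.refl
    sign-cases Sign.- p m = m ≡.refl

    module _ {o a b c d : Vertex} (oa : o ~ a) (ab : a ~ b) (bc : b ~ c) (od : o ~ d) where
      -- The side of d is determined by a, b and o alone, so two other arms cannot start on
      -- different sides of the circle o a.
      long-middle-side : Unique (o ∷ a ∷ b ∷ c ∷ d ∷ []) → ε oa ≡ Sign.+ → ε ab ≡ Sign.- → ε od ≡ Sign.+ →
        χ a b o ≡ χ a o d
      long-middle-side !v oa+ ab- od+ with χ a b o ≟ˢ χ a o d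
      ... | yes abo≡aod = abo≡aod
      ... | no  abo≢aod = ⊥-elim (all-short-long-middle (χ a b o) (χ a o d) (χ b o d) (χ a b d) abo≢aod
            (crossing-with ab od ab- od+ (≠ 1F 0F) (≠ 1F 4F) (≠ 2F 0F) (≠ 2F 4F))
            (χ c o a) (χ b c o) (χ b c a)
            (≡.subst (λ s → Crosses Sign.+ Sign.+ s (χ c o a) (χ b c o) (χ b c a)) (≡.sym (χ-cyclic a b o))
              (crossing-with bc oa bc+ oa+ (≠ 2F 0F) (≠ 2F 1F) (≠ 3F 0F) (≠ 3F 1F)))
            (χ c o d) (χ b c d)
            (crossing-with bc od bc+ od+ (≠ 2F 0F) (≠ 2F 4F) (≠ 3F 0F) (≠ 3F 4F)))
        where
        ≠ = lookup-≢ !v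
        bc+ = ε-path ab bc (≠ 1F 3F) ab-

    -- The last hypothesis says that the circle o a separates d from e. But both lie on the side of
    -- b if a b is short, and both on the other side if it is long.
    middle-impossible : ∀ {o} (A D E : Arm o) → Unique (o ∷ joints A ++ joints D ++ joints E) →
      ε (Arm.oa A) ≡ Sign.+ → ε (Arm.oa D) ≡ Sign.+ → ε (Arm.oa E) ≡ Sign.+ →
      χ (Arm.a A) o (Arm.a D) ≢ χ (Arm.a A) o (Arm.a E) → ⊥
    middle-impossible {o} (arm {a} {b} oa ab bc) (arm {d} od _ _) (arm {e} oe _ _) !v oa+ od+ oe+ aod≢aoe =
      sign-cases (ε ab)
        (λ ab+ → all-short-one-side (χ a b o) (χ a o d) (χ b o d) (χ a b d)
          (crossing-with ab od ab+ od+ (≠ 1F 0F) (≠ 1F 4F) (≠ 2F 0F) (≠ 2F 4F))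
          (χ a o e) (χ b o e) (χ a b e) aod≢aoe
          (crossing-with ab oe ab+ oe+ (≠ 1F 0F) (≠ 1F 7F) (≠ 2F 0F) (≠ 2F 7F)))
        (λ ab- → aod≢aoe (≡.trans
          (≡.sym (long-middle-side oa ab bc od (select (0F ∷ 1F ∷ 2F ∷ 3F ∷ 4F ∷ [])) oa+ ab- od+))
          (long-middle-side oa ab bc oe (select (0F ∷ 1F ∷ 2F ∷ 3F ∷ 7F ∷ [])) oa+ ab- oe+)))
      where
      ≠ = lookup-≢ !v

      select : ∀ is {u : True (DecUnique.unique? Finₚ._≟_ is)} → Unique (List.map (lookup _) is)
      select is {u} = map⁺ (lookup-injective !v) (toWitness u)

    module _ {o : Vertex} (P D A : Arm o) (!v : Unique (o ∷ joints P ++ joints D ++ joints A))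
      (op- : ε (Arm.oa P) ≡ Sign.-) where
      open Arm P using () renaming (a to p; b to q; oa to op; ab to pq)
      open Arm D using () renaming (a to d; oa to od)
      open Arm A hiding (joints)

      -- The positions in !v: o 0; p, q 1, 2; d 4; a, b, c 7, 8, 9.
      private
        ≠ = lookup-≢ !v
        pq+ = ε-path op pq (≠ 0F 2F) op-
        od+ = ε-star op od (≠ 1F 4F) op-
        oa+ = ε-star op oa (≠ 1F 7F) op-
        pq×oa = crossing-with pq oa pq+ oa+ (≠ 1F 0F) (≠ 1F 7F) (≠ 2F 0F) (≠ 2F 7F)
        pq×od = crossing-with pq od pq+ od+ (≠ 1F 0F) (≠ 1F 4F) (≠ 2F 0F) (≠ 2F 4F)

        pq×oa′ : Crosses Sign.+ Sign.+ (χ p o a) (χ q o a) (χ p q o) (χ a p q)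
        pq×oa′ = ≡.subst (Crosses Sign.+ Sign.+ (χ p o a) (χ q o a) (χ p q o)) (≡.sym (χ-cyclic a p q)) pq×oa

      -- Since p q crosses both o d and o a, the hypothesis says that o d lies between o p and o a
      -- around o, so that o a is crossed last.
      long-impossible-ordered : χ p o d ≢ χ a o d → ⊥
      long-impossible-ordered pod≢aod = sign-cases (ε ab)
        (λ ab+ → long-short (χ p o a) (χ q o a) (χ p q o) (χ a p q) pq×oa′ (χ a o p)
          poa≢aop (χ p o d) (χ q o d) (χ p q d) pq×od (χ a o d) pod≢aod
          (χ b o d) (χ a b o) (χ a b d)
          (crossing-with ab od ab+ od+ (≠ 7F 0F) (≠ 7F 4F) (≠ 8F 0F) (≠ 8F 4F))
          (χ b p q) (χ a b p) (χ a b q)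
          (crossing-with ab pq ab+ pq+ (≠ 7F 1F) (≠ 7F 2F) (≠ 8F 1F) (≠ 8F 2F))
          (χ b o p)
          (crossing-with ab op ab+ op- (≠ 7F 0F) (≠ 7F 1F) (≠ 8F 0F) (≠ 8F 1F)))
        (λ ab- → let bc+ = ε-path ab bc (≠ 7F 9F) ab- in
          long-long (χ p o a) (χ q o a) (χ p q o) (χ a p q) pq×oa′ (χ a o p)
          poa≢aop (χ p o d) (χ q o d) (χ p q d) pq×od (χ a o d) pod≢aod
          (χ a b o) (χ c o a) (χ b c o) (χ b c a)
          (≡.subst (λ s → Crosses Sign.+ Sign.+ s (χ c o a) (χ b c o) (χ b c a)) (≡.sym (χ-cyclic a b o))
            (crossing-with bc oa bc+ oa+ (≠ 8F 0F) (≠ 8F 7F) (≠ 9F 0F) (≠ 9F 7F)))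
          (χ b o d) (χ c o d) (χ b c d)
          (crossing-with bc od bc+ od+ (≠ 8F 0F) (≠ 8F 4F) (≠ 9F 0F) (≠ 9F 4F))
          (χ a b d)
          (crossing-with ab od ab- od+ (≠ 7F 0F) (≠ 7F 4F) (≠ 8F 0F) (≠ 8F 4F))
          (χ b p q) (χ a b p) (χ a b q)
          (crossing-with ab pq ab- pq+ (≠ 7F 1F) (≠ 7F 2F) (≠ 8F 1F) (≠ 8F 2F))
          (χ b o p)
          (crossing-with ab op ab- op- (≠ 7F 0F) (≠ 7F 1F) (≠ 8F 0F) (≠ 8F 1F))
          (χ c o p) (χ b c p)
          (crossing-with bc op bc+ op- (≠ 8F 0F) (≠ 8F 1F) (≠ 9F 0F) (≠ 9F 1F))
          (χ c p q) (χ b c q)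
          (crossing-with bc pq bc+ pq+ (≠ 8F 1F) (≠ 8F 2F) (≠ 9F 1F) (≠ 9F 2F))
          (≡.subst₂ (λ s t → ZeroSum (χ b c o Sign.* s) (opposite (χ b c p Sign.* t)) (χ b c a Sign.* χ b o p))
            (≡.sym (χ-cyclic a b p)) (≡.sym (χ-cyclic a b o))
            (χ-zeroSum (≠ 8F 9F) (≠ 8F 0F) (≠ 8F 1F) (≠ 8F 7F) (≠ 9F 0F)
              (≠ 9F 1F) (≠ 9F 7F) (≠ 0F 1F) (≠ 0F 7F) (≠ 1F 7F)))
          (zeroSum-at-p (χ-zeroSum (≠ 1F 2F) (≠ 1F 7F) (≠ 1F 8F) (≠ 1F 0F) (≠ 2F 7F)
              (≠ 2F 8F) (≠ 2F 0F) (≠ 7F 8F) (≠ 7F 0F) (≠ 8F 0F))))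
        where
        poa≢aop = χ-reverse (≠ 1F 0F) (≠ 0F 7F) (≠ 1F 7F)
        zeroSum-at-p :
          ZeroSum (χ p q a Sign.* χ p b o) (opposite (χ p q b Sign.* χ p a o)) (χ p q o Sign.* χ p a b) →
          ZeroSum (χ a p q Sign.* χ b o p) (opposite (χ b p q Sign.* χ a o p)) (χ p q o Sign.* χ a b p)
        zeroSum-at-p h
          rewrite χ-cyclic p b o | χ-cyclic p a o | χ-cyclic p a b
                | χ-cyclic a p q | χ-cyclic b p q = h

      -- If o a is not crossed last, then o d is: the conclusion is the hypothesis of
      -- `long-impossible-ordered` with the two arms exchanged.
      other-arm : χ p o d ≡ χ a o d → χ p o a ≢ χ d o a
      other-arm pod≡aod poa≡doa = opposite-sides (χ p o a) (χ q o a) (χ p q o) (χ p q a) pq×oa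
        (χ p o d) (χ q o d) (χ p q d) pq×od (χ a o d) (χ d o a)
        (χ-reverse (≠ 7F 0F) (≠ 0F 4F) (≠ 7F 4F)) (≡.sym pod≡aod) (≡.sym poa≡doa)

    long-impossible : ∀ {o} (P D A : Arm o) → Unique (o ∷ joints P ++ joints D ++ joints A) →
      ε (Arm.oa P) ≡ Sign.- → ⊥
    long-impossible {o} P D A !v op- with χ (Arm.a P) o (Arm.a D) ≟ˢ χ (Arm.a A) o (Arm.a D)
    ... | no  pod≢aod = long-impossible-ordered P D A !v op- pod≢aod
    ... | yes pod≡aod = long-impossible-ordered P A D
      (Unique-resp-↭ (prep o (++⁺ˡ (joints P) (++-comm (joints D) (joints A)))) !v) op-
      (other-arm P D A !v op- pod≡aod)

    spider-impossible : ¬ Spider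
    spider-impossible record { o = o ; A = A ; B = B ; C = C ; unique = !v } =
      sign-cases (ε (Arm.oa A)) (λ A+ →
      sign-cases (ε (Arm.oa B)) (λ B+ →
      sign-cases (ε (Arm.oa C)) (λ C+ → all-short-impossible A+ B+ C+)
      (long-impossible C A B (Unique-resp-↭ (prep o rotate) !v)))
      (long-impossible B A C !BAC))
      (long-impossible A B C !v)
      where
      rotate : joints A ++ joints B ++ joints C ↭ joints C ++ joints A ++ joints B
      rotate = ++-comm (joints A ++ joints B) (joints C)
      !BAC = Unique-resp-↭ (prep o (shifts (joints A) (joints B))) !v
      open Arm A using () renaming (a to a₁)
      open Arm B using () renaming (a to a₂)
      open Arm C using () renaming (a to a₃)
      ≠ = lookup-≢ !v

      all-short-impossible : ε (Arm.oa A) ≡ Sign.+ → ε (Arm.oa B) ≡ Sign.+ → ε (Arm.oa C) ≡ Sign.+ → ⊥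
      all-short-impossible A+ B+ C+ with χ a₁ o a₂ ≟ˢ χ a₁ o a₃ | χ a₂ o a₁ ≟ˢ χ a₂ o a₃
      ... | no 12≢13  | _         = middle-impossible A B C !v A+ B+ C+ 12≢13
      ... | yes _     | no 21≢23  = middle-impossible B A C !BAC B+ A+ C+ 21≢23
      ... | yes 12≡13 | yes 21≡23 = middle-impossible C A B (Unique-resp-↭ (prep o rotate) !v) C+ A+ B+
        (some-middle (χ a₁ o a₂) (χ a₂ o a₁) (χ a₁ o a₃) (χ a₃ o a₁) (χ a₂ o a₃) (χ a₃ o a₂)
          (χ-reverse (≠ 1F 0F) (≠ 0F 4F) (≠ 1F 4F))
          (χ-reverse (≠ 1F 0F) (≠ 0F 7F) (≠ 1F 7F))
          (χ-reverse (≠ 4F 0F) (≠ 0F 7F) (≠ 4F 7F)) 12≡13 21≡23)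

-- Walks in graphs and trees

module Walks (G : Graph) where
  open Graph G
  open import Data.Nat.Base using (_≤_; _<_; _+_)
  open ≡ using (refl)
  open import Relation.Binary.Construct.Closure.ReflexiveTransitive using (ε; _◅_; _◅◅_)
  open import Relation.Binary.Construct.Closure.ReflexiveTransitive.Properties using (◅◅-assoc)
  open DecMembership (Finₚ._≟_ {order}) using (_∈?_)

  -- The last vertex is left out so that in a concatenation the junction is counted once.
  initial : ∀ {u v} → Walk u v → List Vertex
  initial ε               = []
  initial (_◅_ {i = u} _ w) = u ∷ initial w

  reverse : ∀ {u v} → Walk u v → Walk v u
  reverse ε       = ε
  reverse (e ◅ w) = reverse w ◅◅ (~-sym e ◅ ε)

  start∈ : ∀ {u v} (w : Walk u v) → u ∈ vertices w
  start∈ ε       = here refl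
  start∈ (_ ◅ _) = here refl

  end∈ : ∀ {u v} (w : Walk u v) → v ∈ vertices w
  end∈ ε       = here refl
  end∈ (_ ◅ w) = there (end∈ w)

  vertices-◅◅ : ∀ {u v x} (w : Walk u v) (w′ : Walk v x) → vertices (w ◅◅ w′) ≡ initial w ++ vertices w′
  vertices-◅◅ ε       w′ = refl
  vertices-◅◅ (_ ◅ w) w′ = ≡.cong (_ ∷_) (vertices-◅◅ w w′)

  vertices-∷ʳ : ∀ {u v x} (w : Walk u v) (e : v ~ x) → vertices (w ◅◅ (e ◅ ε)) ≡ vertices w ∷ʳ x
  vertices-∷ʳ ε       e = refl
  vertices-∷ʳ (_ ◅ w) e = ≡.cong (_ ∷_) (vertices-∷ʳ w e)

  length-◅◅ : ∀ {u v x} (w : Walk u v) (w′ : Walk v x) → length (w ◅◅ w′) ≡ length w + length w′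
  length-◅◅ ε       w′ = refl
  length-◅◅ (_ ◅ w) w′ = ≡.cong suc (length-◅◅ w w′)

  vertices-reverse : ∀ {u v} (w : Walk u v) → vertices (reverse w) ≡ List.reverse (vertices w)
  vertices-reverse ε = refl
  vertices-reverse (_◅_ {i = u} e w) = ≡.trans (vertices-∷ʳ (reverse w) (~-sym e))
    (≡.trans (≡.cong (_∷ʳ u) (vertices-reverse w)) (≡.sym (Listₚ.unfold-reverse u (vertices w))))

  length-reverse : ∀ {u v} (w : Walk u v) → length (reverse w) ≡ length w
  length-reverse ε       = refl
  length-reverse (e ◅ w) = ≡.trans (length-◅◅ (reverse w) (~-sym e ◅ ε))
    (≡.trans (ℕₚ.+-comm (length (reverse w)) 1) (≡.cong suc (length-reverse w)))

  reverse-◅◅ : ∀ {u v x} (w : Walk u v) (w′ : Walk v x) → reverse (w ◅◅ w′) ≡ reverse w′ ◅◅ reverse w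
  reverse-◅◅ ε       w′ = ≡.sym (◅◅-identityʳ (reverse w′))
    where
    ◅◅-identityʳ : ∀ {u v} (w : Walk u v) → w ◅◅ ε ≡ w
    ◅◅-identityʳ ε       = refl
    ◅◅-identityʳ (e ◅ w) = ≡.cong (e ◅_) (◅◅-identityʳ w)
  reverse-◅◅ (e ◅ w) w′ = ≡.trans (≡.cong (_◅◅ (~-sym e ◅ ε)) (reverse-◅◅ w w′))
    (◅◅-assoc (reverse w′) (reverse w) (~-sym e ◅ ε))

  reverse-↭ : ∀ {u v} (w : Walk u v) → vertices (reverse w) ↭ vertices w
  reverse-↭ w = ↭-trans (↭-reflexive (vertices-reverse w)) (↭-reverse (vertices w))

  reverse-isPath : ∀ {u v} (w : Walk u v) → IsPath w → IsPath (reverse w)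
  reverse-isPath w = Unique-resp-↭ (↭-sym (reverse-↭ w))

  initial⊆ : ∀ {u v} (w : Walk u v) {x} → x ∈ initial w → x ∈ vertices w
  initial⊆ (_ ◅ w) (here refl) = here refl
  initial⊆ (_ ◅ w) (there x∈)  = there (initial⊆ w x∈)

  ∈-initial : ∀ {u v} (w : Walk u v) {x} → x ∈ vertices w → x ≢ v → x ∈ initial w
  ∈-initial ε       (here refl) x≢v = contradiction refl x≢v
  ∈-initial (_ ◅ w) (here refl) x≢v = here refl
  ∈-initial (_ ◅ w) (there x∈)  x≢v = there (∈-initial w x∈ x≢v)

  ∈-◅◅⁻ : ∀ {u v x} (w : Walk u v) (w′ : Walk v x) {y} → y ∈ vertices (w ◅◅ w′) → y ∈ initial w ⊎ y ∈ vertices w′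
  ∈-◅◅⁻ w w′ y∈ = ∈-++⁻ (initial w) (≡.subst (_ ∈_) (vertices-◅◅ w w′) y∈)

  ∈-◅◅ʳ : ∀ {u v x} (w : Walk u v) {w′ : Walk v x} {y} → y ∈ vertices w′ → y ∈ vertices (w ◅◅ w′)
  ∈-◅◅ʳ ε       y∈ = y∈
  ∈-◅◅ʳ (_ ◅ w) y∈ = there (∈-◅◅ʳ w y∈)

  ∈-◅◅ˡ : ∀ {u v x} (w : Walk u v) {w′ : Walk v x} {y} → y ∈ vertices w → y ∈ vertices (w ◅◅ w′)
  ∈-◅◅ˡ ε {w′}  (here refl) = start∈ w′
  ∈-◅◅ˡ (_ ◅ w) (here refl) = here refl
  ∈-◅◅ˡ (_ ◅ w) (there y∈)  = there (∈-◅◅ˡ w y∈)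

  suffix-isPath : ∀ {u v x} (w : Walk u v) {w′ : Walk v x} → IsPath (w ◅◅ w′) → IsPath w′
  suffix-isPath ε       !w       = !w
  suffix-isPath (_ ◅ w) (_ ∷ !w) = suffix-isPath w !w

  prefix-isPath : ∀ {u v x} (w : Walk u v) {w′ : Walk v x} → IsPath (w ◅◅ w′) → IsPath w
  prefix-isPath ε       _         = [] ∷ []
  prefix-isPath (_ ◅ w) (u∉ ∷ !w) =
    All.tabulate (λ x∈ → All.lookup u∉ (∈-◅◅ˡ w x∈)) ∷ prefix-isPath w !w

  initial-disjoint : ∀ {u v x} (w : Walk u v) {w′ : Walk v x} → IsPath (w ◅◅ w′) →
    ∀ {y} → y ∈ initial w → y ∉ vertices w′
  initial-disjoint (_ ◅ w) (u∉ ∷ _)  (here refl) y∈′ = All.lookup u∉ (∈-◅◅ʳ w y∈′) refl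
  initial-disjoint (_ ◅ w) (_ ∷ !w) (there y∈)  y∈′ = initial-disjoint w !w y∈ y∈′

  ◅-isPath : ∀ {u v x} (e : u ~ v) {w : Walk v x} → u ∉ vertices w → IsPath w → IsPath (e ◅ w)
  ◅-isPath e u∉w !w = ¬Any⇒All¬ _ u∉w ∷ !w

  ◅◅-isPath : ∀ {u v x} (w : Walk u v) {w′ : Walk v x} → IsPath w → IsPath w′ →
    (∀ {y} → y ∈ initial w → y ∉ vertices w′) → IsPath (w ◅◅ w′)
  ◅◅-isPath ε _ !w′ _ = !w′
  ◅◅-isPath (e ◅ w) {w′} (u∉w ∷ !w) !w′ disjoint = ◅-isPath e u∉ (◅◅-isPath w !w !w′ (disjoint ∘ there))
    where
    u∉ : _ ∉ vertices (w ◅◅ w′)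
    u∉ u∈ with ∈-◅◅⁻ w w′ u∈
    ... | inj₁ u∈w  = All.lookup u∉w (initial⊆ w u∈w) refl
    ... | inj₂ u∈w′ = disjoint (here refl) u∈w′

  closed-path : ∀ {u} (w : Walk u u) → IsPath w → ¬ 0 < length w
  closed-path (_ ◅ w) (u∉w ∷ _) _ = All.lookup u∉w (end∈ w) refl

  open-path : ∀ {u v} (w : Walk u v) → IsPath w → 0 < length w → u ≢ v
  open-path w !w 0<w refl = closed-path w !w 0<w

  record Split {u v} (w : Walk u v) (x : Vertex) : Set where
    constructor split
    field
      {prefix} : Walk u x
      {suffix} : Walk x v
      eq       : w ≡ prefix ◅◅ suffix

  splitAt : ∀ {u v} (w : Walk u v) {x} → x ∈ vertices w → Split w x
  splitAt ε       (here refl) = split {prefix = ε} refl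
  splitAt (e ◅ w) (here refl) = split {prefix = ε} refl
  splitAt (e ◅ w) (there x∈) with splitAt w x∈
  ... | split {prefix = w′} refl = split {prefix = e ◅ w′} refl

  toPath : ∀ {u v} → Walk u v → ∃ λ (w : Walk u v) → IsPath w
  toPath ε = ε , [] ∷ []
  toPath (_◅_ {i = u} e w) with toPath w
  ... | p , !p with u ∈? vertices p
  ...   | no  u∉p = e ◅ p , ◅-isPath e u∉p !p
  -- The walk returns to u, so the loop is cut off by starting from that later visit.
  ...   | yes u∈p with splitAt p u∈p
  ...     | split {prefix} {suffix} refl = suffix , suffix-isPath prefix !p

  steps-◅◅ˡ : ∀ {u v x} (w : Walk u v) {w′ : Walk v x} {s} → s ∈ steps w → s ∈ steps (w ◅◅ w′)
  steps-◅◅ˡ (_ ◅ w) (here refl) = here refl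
  steps-◅◅ˡ (_ ◅ w) (there s∈)  = there (steps-◅◅ˡ w s∈)

  steps-◅◅ʳ : ∀ {u v x} (w : Walk u v) {w′ : Walk v x} {s} → s ∈ steps w′ → s ∈ steps (w ◅◅ w′)
  steps-◅◅ʳ ε       s∈ = s∈
  steps-◅◅ʳ (_ ◅ w) s∈ = there (steps-◅◅ʳ w s∈)

  step-source : ∀ {u v} (w : Walk u v) {x y} → (x , y) ∈ steps w → x ∈ initial w
  step-source (_ ◅ w) (here refl) = here refl
  step-source (_ ◅ w) (there s∈)  = there (step-source w s∈)

  step-target : ∀ {u v} (w : Walk u v) {x y} → (x , y) ∈ steps w → y ∈ vertices w
  step-target (_ ◅ w) (here refl) = there (start∈ w)
  step-target (_ ◅ w) (there s∈)  = there (step-target w s∈)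

  traverses-ends : ∀ {u v} (w : Walk u v) {x y} → Traverses w x y → x ∈ vertices w × y ∈ vertices w
  traverses-ends w (inj₁ s∈) = initial⊆ w (step-source w s∈) , step-target w s∈
  traverses-ends w (inj₂ s∈) = step-target w s∈ , initial⊆ w (step-source w s∈)

  edgeDisjoint : ∀ {u v u′ v′} (w : Walk u v) (w′ : Walk u′ v′) →
    (∀ {x} → x ∈ initial w → x ∉ vertices w′) → EdgeDisjoint w w′
  edgeDisjoint w w′ disjoint x y (inj₁ s∈) t = disjoint (step-source w s∈) (proj₁ (traverses-ends w′ t))
  edgeDisjoint w w′ disjoint x y (inj₂ s∈) t = disjoint (step-source w s∈) (proj₂ (traverses-ends w′ t))

  -- Pigeonhole: a path has one more vertex than edges, and its vertices are distinct.
  length<order : ∀ {u v} (w : Walk u v) → IsPath w → length w < order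
  length<order w !w = ≡.subst (_≤ order) (length-vertices w) (Finₚ.injective⇒≤ (lookup-injective !w))
    where
    length-vertices : ∀ {u v} (w : Walk u v) → List.length (vertices w) ≡ suc (length w)
    length-vertices ε       = refl
    length-vertices (_ ◅ w) = ≡.cong suc (length-vertices w)

  -- The list holds the vertices already used. With the exact length fixed, existence is decidable
  -- by trying every neighbour as the next vertex.
  PathAvoiding : ℕ → Vertex → List Vertex → Set
  PathAvoiding k u xs = ∃ λ v → Σ (Walk u v) λ w → length w ≡ k × Unique (vertices w ++ xs)

  pathAvoiding? : ∀ k u xs → Dec (PathAvoiding k u xs)
  pathAvoiding? zero u xs = map′
    (λ !xs → u , ε , refl , !xs) (λ { (_ , ε , _ , !xs) → !xs }) (DecUnique.unique? Finₚ._≟_ (u ∷ xs))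
  pathAvoiding? (suc k) u xs = map′
    (λ { (x , e , v , w , eq , !w) → v , e ◅ w , ≡.cong suc eq , Unique-resp-↭ (shift u (vertices w) xs) !w })
    (λ { (v , _◅_ {j = x} e w , eq , !w) →
         x , e , v , w , ℕₚ.suc-injective eq , Unique-resp-↭ (↭-sym (shift u (vertices w) xs)) !w })
    (Finₚ.any? λ x → T? (adj u x) ×-dec pathAvoiding? k x (u ∷ xs))

  LongestPath : Set
  LongestPath = ∃₂ λ u v → Σ (Walk u v) IsLongestPath

  longestPath : Vertex → LongestPath
  longestPath x = search order λ w !w → ℕₚ.<⇒≤ (length<order w !w)
    where
    search : ∀ k → (∀ {u v} (w : Walk u v) → IsPath w → length w ≤ k) → LongestPath
    search zero    bound = x , x , ε , [] ∷ [] , bound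
    -- The bound on path lengths is lowered until it is attained; at zero the trivial path at x
    -- attains it.
    search (suc k) bound with Finₚ.any? (λ u → pathAvoiding? (suc k) u [])
    ... | yes (u , v , w , eq , !w) = u , v , w , ≡.subst Unique (Listₚ.++-identityʳ _) !w
          , λ q !q → ≡.subst (length q ≤_) (≡.sym eq) (bound q !q)
    ... | no ¬w = search k λ {u} {v} w !w → ℕ.s≤s⁻¹ (ℕₚ.≤∧≢⇒< (bound w !w)
          λ eq → ¬w (u , v , w , eq , ≡.subst Unique (≡.sym (Listₚ.++-identityʳ _)) !w))

  record Attachment (x : Vertex) (S : List Vertex) : Set where
    field
      {foot}   : Vertex
      path     : Walk x foot
      isPath   : IsPath path
      foot∈    : foot ∈ S
      off      : ∀ {y} → y ∈ initial path → y ∉ S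

  -- The walk is cut at its first vertex in S, so no earlier vertex lies in S.
  attach : ∀ {x y} (w : Walk x y) {S} → IsPath w → y ∈ S → Attachment x S
  attach {x} w {S} !w y∈S with truncate w y∈S
    where
    truncate : ∀ {x y} (w : Walk x y) → y ∈ S →
      ∃ λ z → Σ (Split w z) λ s → z ∈ S × (∀ {y} → y ∈ initial (Split.prefix s) → y ∉ S)
    truncate {x} w y∈S with x ∈? S
    truncate {x} w       y∈S | yes x∈S = x , split {prefix = ε} refl , x∈S , λ ()
    truncate {x} ε       y∈S | no  x∉S = contradiction y∈S x∉S
    truncate {x} (e ◅ w) y∈S | no  x∉S with truncate w y∈S
    ... | z , split {prefix = p} refl , z∈S , off = z , split {prefix = e ◅ p} refl , z∈S ,
          λ { (here refl) → x∉S ; (there y∈) → off y∈ }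
  ... | z , split {prefix = p} refl , z∈S , off = record
        { path = p ; isPath = prefix-isPath p !w ; foot∈ = z∈S ; off = off }

-- Longest paths, branches and legs in a tree.

module Caterpillars (G : Graph) (tree : Graph.IsTree G) where
  open Graph G
  open IsTree tree
  open Walks G
  open Spiders G
  open import Data.Nat.Base using (_≤_; _<_)
  open ≡ using (refl)
  open import Relation.Binary.Construct.Closure.ReflexiveTransitive using (ε; _◅_; _◅◅_)
  open DecMembership (Finₚ._≟_ {order}) using (_∈?_)

  -- A path of at least two edges between adjacent vertices would close up to a cycle, so the path
  -- is that single edge.
  chord : ∀ {x y} (w : Walk x y) → IsPath w → x ~ y → (x , y) ∈ steps w
  chord ε           _  e = contradiction e (~-irrefl refl)
  chord (_ ◅ ε)     _  e = here refl
  chord w@(_ ◅ _ ◅ _) !w e = contradiction (~-sym e) (acyclic w !w (s≤s (s≤s z≤n)))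

  path-induced : ∀ {u v} (w : Walk u v) → IsPath w → ∀ {x y} → x ∈ vertices w → y ∈ vertices w → x ~ y →
    Traverses w x y
  path-induced w !w x∈ y∈ e with splitAt w x∈
  ... | split {prefix} {suffix} refl with ∈-◅◅⁻ prefix suffix y∈
  ...   | inj₁ y∈p with splitAt prefix (initial⊆ prefix y∈p)
  ...     | split {w₁} {w₂} refl = inj₂ (steps-◅◅ˡ (w₁ ◅◅ w₂)
            (steps-◅◅ʳ w₁ (chord w₂ (suffix-isPath w₁ (prefix-isPath (w₁ ◅◅ w₂) !w)) (~-sym e))))
  path-induced w !w x∈ y∈ e | split {prefix} {suffix} refl | inj₂ y∈s with splitAt suffix y∈s
  ...     | split {w₁} {w₂} refl = inj₁ (steps-◅◅ʳ prefix
            (steps-◅◅ˡ w₁ (chord w₁ (prefix-isPath w₁ (suffix-isPath prefix !w)) e)))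

  reverse-longest : ∀ {u v} (p : Walk u v) → IsLongestPath p → IsLongestPath (reverse p)
  reverse-longest p (!p , longest) = reverse-isPath p !p ,
    λ q !q → ≡.subst (length q ≤_) (≡.sym (length-reverse p)) (longest q !q)

  -- Replacing p₁ by the branch r gives another path, which cannot be longer than the longest one.
  branch≤prefix : ∀ {u z v x} (p₁ : Walk u z) (p₂ : Walk z v) → IsLongestPath (p₁ ◅◅ p₂) →
    (r : Walk x z) → IsPath r → (∀ {y} → y ∈ initial r → y ∉ vertices (p₁ ◅◅ p₂)) →
    length r ≤ length p₁
  branch≤prefix p₁ p₂ (!p , longest) r !r off = ℕₚ.+-cancelʳ-≤ (length p₂) _ _
    (≡.subst₂ _≤_ (length-◅◅ r p₂) (length-◅◅ p₁ p₂)
      (longest (r ◅◅ p₂) (◅◅-isPath r !r (suffix-isPath p₁ !p) λ y∈ y∈p → off y∈ (∈-◅◅ʳ p₁ y∈p))))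

  branch≤suffix : ∀ {u z v x} (p₁ : Walk u z) (p₂ : Walk z v) → IsLongestPath (p₁ ◅◅ p₂) →
    (r : Walk x z) → IsPath r → (∀ {y} → y ∈ initial r → y ∉ vertices (p₁ ◅◅ p₂)) →
    length r ≤ length p₂
  branch≤suffix p₁ p₂ longest r !r off = ≡.subst (length r ≤_) (length-reverse p₂)
    (branch≤prefix (reverse p₂) (reverse p₁) (≡.subst IsLongestPath eq (reverse-longest (p₁ ◅◅ p₂) longest)) r !r
      λ y∈ y∈p → off y∈ (∈-resp-↭ (reverse-↭ (p₁ ◅◅ p₂)) (≡.subst (λ w → _ ∈ vertices w) (≡.sym eq) y∈p)))
    where eq = reverse-◅◅ p₁ p₂

  -- Both parts of the spine at z are at least as long as the branch, hence nonempty, so z is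
  -- neither end.
  branch-foot-internal : ∀ {u z v x} (p : Walk u v) → IsLongestPath p → z ∈ vertices p →
    (r : Walk x z) → IsPath r → (∀ {y} → y ∈ initial r → y ∉ vertices p) → 0 < length r → Internal p z
  branch-foot-internal p longest z∈p r !r off 0<r with splitAt p z∈p
  ... | split {p₁} {p₂} refl = z∈p
      , (open-path p₁ (prefix-isPath p₁ (proj₁ longest))
          (ℕₚ.<-≤-trans 0<r (branch≤prefix p₁ p₂ longest r !r off)) ∘ ≡.sym)
      , open-path p₂ (suffix-isPath p₁ (proj₁ longest))
          (ℕₚ.<-≤-trans 0<r (branch≤suffix p₁ p₂ longest r !r off))

  record ArmAlong {z v} (w : Walk z v) : Set where
    field
      theArm  : Arm z
      distinct : Unique (z ∷ joints theArm)
      along   : ∀ {y} → y ∈ joints theArm → y ∈ vertices w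

  armAlong : ∀ {z v} (w : Walk z v) → IsPath w → 3 ≤ length w → ArmAlong w
  armAlong (e₁ ◅ e₂ ◅ e₃ ◅ w) !w _ = record
    { theArm = arm e₁ e₂ e₃
    ; distinct = prefix-isPath (e₁ ◅ e₂ ◅ e₃ ◅ ε) {w} !w
    ; along = λ y∈ → ∈-◅◅ˡ (e₁ ◅ e₂ ◅ e₃ ◅ ε) {w} (there y∈)
    }
  armAlong (_ ◅ ε)     _ (s≤s ())
  armAlong (_ ◅ _ ◅ ε) _ (s≤s (s≤s ()))

  spider : ∀ {z u v x} (a : Walk z u) (b : Walk z v) (c : Walk z x) →
    IsPath a → IsPath b → IsPath c → 3 ≤ length a → 3 ≤ length b → 3 ≤ length c →
    (∀ {y} → y ∈ vertices a → y ∈ vertices b → y ≡ z) →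
    (∀ {y} → y ∈ vertices a → y ∈ vertices c → y ≡ z) →
    (∀ {y} → y ∈ vertices b → y ∈ vertices c → y ≡ z) → Spider
  spider {z} a b c !a !b !c 3≤a 3≤b 3≤c ab ac bc
    with armAlong a !a 3≤a | armAlong b !b 3≤b | armAlong c !c 3≤c
  ... | record { theArm = A ; distinct = z∉A ∷ !A ; along = A⊆ }
      | record { theArm = B ; distinct = z∉B ∷ !B ; along = B⊆ }
      | record { theArm = C ; distinct = z∉C ∷ !C ; along = C⊆ } = record
    { A = A ; B = B ; C = C
    ; unique = ¬Any⇒All¬ _ z∉ ∷
        ++⁺ !A (++⁺ !B !C (λ (y∈B , y∈C) → All.lookup z∉B y∈B (≡.sym (bc (B⊆ y∈B) (C⊆ y∈C)))))
          λ (y∈A , y∈BC) → All.lookup z∉A y∈A (≡.sym (A∩BC y∈A (∈-++⁻ (joints B) y∈BC)))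
    }
    where
    A∩BC : ∀ {y} → y ∈ joints A → y ∈ joints B ⊎ y ∈ joints C → y ≡ z
    A∩BC y∈A (inj₁ y∈B) = ab (A⊆ y∈A) (B⊆ y∈B)
    A∩BC y∈A (inj₂ y∈C) = ac (A⊆ y∈A) (C⊆ y∈C)

    z∉ : z ∉ joints A ++ joints B ++ joints C
    z∉ z∈ with ∈-++⁻ (joints A) z∈
    ... | inj₁ z∈A = All.lookup z∉A z∈A refl
    ... | inj₂ z∈BC with ∈-++⁻ (joints B) z∈BC
    ...   | inj₁ z∈B = All.lookup z∉B z∈B refl
    ...   | inj₂ z∈C = All.lookup z∉C z∈C refl

  long-branch⇒spider : ∀ {u z v x} (p : Walk u v) → IsLongestPath p → z ∈ vertices p →
    (r : Walk x z) → IsPath r → (∀ {y} → y ∈ initial r → y ∉ vertices p) → 3 ≤ length r → Spider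
  long-branch⇒spider {z = z} p longest z∈p r !r off 3≤r with splitAt p z∈p
  ... | split {p₁} {p₂} refl = spider (reverse p₁) p₂ (reverse r)
      (reverse-isPath p₁ (prefix-isPath p₁ !p)) (suffix-isPath p₁ !p) (reverse-isPath r !r)
      (≡.subst (3 ≤_) (≡.sym (length-reverse p₁)) (ℕₚ.≤-trans 3≤r (branch≤prefix p₁ p₂ longest r !r off)))
      (ℕₚ.≤-trans 3≤r (branch≤suffix p₁ p₂ longest r !r off))
      (≡.subst (3 ≤_) (≡.sym (length-reverse r)) 3≤r)
      (λ y∈p₁ y∈p₂ → meet-at-z p₁ (∈-resp-↭ (reverse-↭ p₁) y∈p₁) λ y∈i → initial-disjoint p₁ !p y∈i y∈p₂)
      (λ y∈p₁ y∈r → meet-at-z r (∈-resp-↭ (reverse-↭ r) y∈r) λ y∈i →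
        off y∈i (∈-◅◅ˡ p₁ (∈-resp-↭ (reverse-↭ p₁) y∈p₁)))
      (λ y∈p₂ y∈r → meet-at-z r (∈-resp-↭ (reverse-↭ r) y∈r) λ y∈i → off y∈i (∈-◅◅ʳ p₁ y∈p₂))
    where
    !p = proj₁ longest
    meet-at-z : ∀ {x} (w : Walk x z) {y} → y ∈ vertices w → y ∉ initial w → y ≡ z
    meet-at-z w {y} y∈w y∉ with y Finₚ.≟ z
    ... | yes y≡z = y≡z
    ... | no  y≢z = contradiction (∈-initial w y∈w y≢z) y∉

  -- Among three distinct vertices a, b, c, either the path from a to b or that from b to c has two
  -- edges, or both pairs are adjacent and a, b, c is a path.
  path-of-length-2 : 2 < order → ∃₂ λ u v → Σ (Walk u v) λ w → IsPath w × 2 ≤ length w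
  path-of-length-2 2<n = extend (toPath (connected a b)) (toPath (connected b c))
    where
    0<n = ℕₚ.<-trans (s≤s z≤n) 2<n
    1<n = ℕₚ.<-trans (s≤s (s≤s z≤n)) 2<n
    a = Fin.fromℕ< 0<n
    b = Fin.fromℕ< 1<n
    c = Fin.fromℕ< 2<n

    fromℕ<-≢ : ∀ {i j} (i<n : i < order) (j<n : j < order) → i ≢ j → Fin.fromℕ< i<n ≢ Fin.fromℕ< j<n
    fromℕ<-≢ i<n j<n i≢j eq = i≢j (Finₚ.fromℕ<-injective _ _ i<n j<n eq)

    a≢b = fromℕ<-≢ 0<n 1<n λ ()
    b≢c = fromℕ<-≢ 1<n 2<n λ ()
    a≢c = fromℕ<-≢ 0<n 2<n λ ()

    single : ∀ {x y} (w : Walk x y) → x ≢ y → 2 ≤ length w ⊎ x ~ y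
    single ε           x≢y = contradiction refl x≢y
    single (e ◅ ε)     _   = inj₂ e
    single (_ ◅ _ ◅ _) _   = inj₁ (s≤s (s≤s z≤n))

    extend : ∃ (IsPath {a} {b}) → ∃ (IsPath {b} {c}) → ∃₂ λ u v → Σ (Walk u v) λ w → IsPath w × 2 ≤ length w
    extend (p , !p) (q , !q) with single p a≢b | single q b≢c
    ... | inj₁ 2≤p | _        = _ , _ , p , !p , 2≤p
    ... | inj₂ _   | inj₁ 2≤q = _ , _ , q , !q , 2≤q
    ... | inj₂ e   | inj₂ f   = _ , _ , e ◅ f ◅ ε
        , ((a≢b ∷ a≢c ∷ []) ∷ (b≢c ∷ []) ∷ [] ∷ []) , s≤s (s≤s z≤n)

  second-internal : ∀ {u v} (p : Walk u v) → IsPath p → 2 ≤ length p → ∃[ y ] (Internal p y × u ~ y)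
  second-internal (e ◅ p) (u∉p ∷ !p) (s≤s 1≤p) = _
    , (there (start∈ p) , (All.lookup u∉p (start∈ p) ∘ ≡.sym) , open-path p !p 1≤p) , e

  module _ (¬spider : ¬ Spider) {u v : Vertex} (p : Walk u v)
    (longest : IsLongestPath p) (2≤p : 2 ≤ length p) where
    private !p = proj₁ longest

    attachment : ∀ x → Attachment x (vertices p)
    attachment x with toPath (connected x u)
    ... | w , !w = attach w !w (start∈ p)

    -- Let r be the branch from x to the spine. If y is on r, then r is the leg; if y is on the
    -- spine, the edge alone is one; otherwise r prolonged to start at y is.
    leg-edge : ∀ {x y} → x ~ y → x ∉ vertices p → Σ[ l ∈ Leg p ] Traverses (Leg.path l) x y
    leg-edge {x} {y} e x∉p with attachment x
    ... | record { path = ε ; foot∈ = x∈p } = contradiction x∈p x∉p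
    ... | record { path = r@(_ ◅ _) ; isPath = !r ; foot∈ = z∈p ; off = off } with y ∈? vertices r | y ∈? vertices p
    ...   | yes y∈r | _ = record
          { path = r ; isPath = !r ; edgeDisjoint = edgeDisjoint r p off
          ; end-internal = branch-foot-internal p longest z∈p r !r off (s≤s z≤n) }
          , path-induced r !r (here refl) y∈r e
    ...   | no y∉r  | yes y∈p = record
          { path = e ◅ ε ; isPath = !e ; edgeDisjoint = edgeDisjoint (e ◅ ε) p x-off
          ; end-internal = branch-foot-internal p longest y∈p (e ◅ ε) !e x-off (s≤s z≤n) }
          , inj₁ (here refl)
          where
          !e = ◅-isPath e {ε} (λ { (here refl) → ~-irrefl refl e }) ([] ∷ [])
          x-off : ∀ {w} → w ∈ x ∷ [] → w ∉ vertices p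
          x-off (here refl) = x∉p
    ...   | no y∉r  | no y∉p = record
          { path = ~-sym e ◅ r ; isPath = !yr ; edgeDisjoint = edgeDisjoint (~-sym e ◅ r) p y-off
          ; end-internal = branch-foot-internal p longest z∈p (~-sym e ◅ r) !yr y-off (s≤s z≤n) }
          , inj₂ (here refl)
          where
          !yr = ◅-isPath (~-sym e) {r} y∉r !r
          y-off : ∀ {w} → w ∈ y ∷ initial r → w ∉ vertices p
          y-off (here refl) = y∉p
          y-off (there w∈)  = off w∈

    spine-or-leg : ∀ x y → x ~ y → Traverses p x y ⊎ (Σ[ l ∈ Leg p ] Traverses (Leg.path l) x y)
    spine-or-leg x y e with x ∈? vertices p | y ∈? vertices p
    ... | yes x∈p | yes y∈p = inj₁ (path-induced p !p x∈p y∈p e)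
    ... | no  x∉p | _       = inj₂ (leg-edge e x∉p)
    ... | yes _   | no y∉p  with leg-edge (~-sym e) y∉p
    ...   | l , t = inj₂ (l , Sum.swap t)

    near : ∀ x → ∃[ y ] (Internal p y × DistanceAtMost 2 x y)
    near x with attachment x
    ... | record { path = ε ; foot∈ = x∈p } with x Finₚ.≟ u | x Finₚ.≟ v
    ...   | no x≢u   | no x≢v   = x , (x∈p , x≢u , x≢v) , ε , z≤n
    ...   | yes refl | _        with second-internal p !p 2≤p
    ...     | y , y-internal , e = y , y-internal , e ◅ ε , s≤s z≤n
    -- The end v of the spine is the start of the reversed spine, so its neighbour there is
    -- internal.
    near x | record { path = ε } | no x≢u | yes refl
          with second-internal (reverse p) (reverse-isPath p !p) (≡.subst (2 ≤_) (≡.sym (length-reverse p)) 2≤p)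
    ...     | y , (y∈ , y≢v , y≢u) , e = y , (∈-resp-↭ (reverse-↭ p) y∈ , y≢u , y≢v) , e ◅ ε , s≤s z≤n
    near x | record { foot = z ; path = r@(_ ◅ _) ; isPath = !r ; foot∈ = z∈p ; off = off } =
      z , branch-foot-internal p longest z∈p r !r off (s≤s z≤n) , r
        -- A branch of length at least 3 would give a spider.
        , ℕₚ.≮⇒≥ (¬spider ∘ long-branch⇒spider p longest z∈p r !r off)

  caterpillar : ¬ Spider → IsAugmentedCaterpillar
  caterpillar ¬spider with order ℕₚ.≤? 2
  ... | yes n≤2 = tree , inj₁ n≤2
  ... | no  n≰2 with longestPath (Fin.fromℕ< 0<n)
    where 0<n = ℕₚ.<-trans (s≤s z≤n) (ℕₚ.≰⇒> n≰2)
  ...   | u , v , p , longest = tree , inj₂ record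
        { spine = p ; longest = longest
        ; spine∪legs = spine-or-leg ¬spider p longest 2≤p
        ; near-spine = near ¬spider p longest 2≤p }
        where
        2≤p : 2 ≤ length p
        2≤p with path-of-length-2 (ℕₚ.≰⇒> n≰2)
        ... | _ , _ , w , !w , 2≤w = ℕₚ.≤-trans 2≤w (proj₂ longest w !w)

theorem3p2 : ∀ {c ℓ} (R : RealNumbers c ℓ) (G : Graph) →
    Graph.IsTree G →
    Sphere.GreatCircleThrackleable R G →
    Graph.IsAugmentedCaterpillar G
theorem3p2 R G tree (D , gp) = Caterpillars.caterpillar G tree λ spider →
  Signs.signedThrackle R G D gp λ S → Spiders.spider-impossible G S spider
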